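{- $\mathrm{ptime}\mbox{ - }2\mathrm{NPD}/\mathrm{poly}=\mathrm{ptime}\mbox{ - }2\mathrm{UPD}/\mathrm{poly}$.
   Context: A promise problem over $\Sigma$ is $(A,R)$ with $A,R\subseteq\Sigma^*$, $A\cap R=\varnothing$; families are $\mathcal{L}=\{(L_n^{(+)},L_n^{(-)})\}_{n\in\mathbb{N}}$ over a common alphabet. A 2npda is a two-way nondeterministic pushdown automaton (finite state set $Q$, input between endmarkers, two-way read-only head, stack alphabet $\Gamma$); it is unambiguous (a 2upda) on $(A,R)$ if it has at most one accepting computation path on each input in $A\cup R$. A machine solves $(A,R)$ if every $x\in A$ has an accepting path and for every $x\in R$ all (halting) paths reject. Size of a 2npda is $|Q|\cdot|\Gamma^{\le e}|$ ($e$ maximal push length); polynomial size means size$(M_n)\le p(n)$ for a polynomial $p$. $\mathrm{ptime}\mbox{ - }2\mathrm{NPD}$ ($\mathrm{ptime}\mbox{ - }2\mathrm{UPD}$) is the class of families $\mathcal{L}$ for which a polynomial-size family of 2npda's (unambiguous 2npda's) $\{M_n\}$ and a polynomial $p$ exist such that $M_n$ solves $(L_n^{(+)},L_n^{(-)})$ within $p(n,|x|)$ steps for all $n$. $\mathcal{C}/\mathrm{poly}$ is the set of families in $\mathcal{C}$ with a polynomial ceiling: a polynomial $p$ with $L_n^{(+)}\cup L_n^{(-)}\subseteq\Sigma^{\le p(n)}$ for all $n$. -}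

module Defs where

open import Data.Nat using (ℕ; zero; suc; _+_; _*_; _^_; _≤_)
open import Data.Fin using (Fin)
open import Data.Bool using (Bool; true; false)
open import Data.List using (List; []; _∷_; _++_; length; last)
open import Data.Maybe using (Maybe; just; nothing)
open import Data.Product using (Σ; _×_; _,_; ∃)
open import Data.Sum using (_⊎_)
open import Data.Empty using (⊥)
open import Relation.Binary.PropositionalEquality using (_≡_)

Poly : Set
Poly = List ℕ

eval : Poly → ℕ → ℕ
eval []       n = 0
eval (a ∷ as) n = a + n * eval as n

Poly2 : Set
Poly2 = List Poly

eval2 : Poly2 → ℕ → ℕ → ℕ
eval2 []       n m = 0
eval2 (p ∷ ps) n m = eval p m + n * eval2 ps n m

data TSym (k : ℕ) : Set where
  cent   : TSym k
  dollar : TSym k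
  sym    : Fin k → TSym k

-- symbol under the head at position i of  ¢ x $  (positions 0 .. |x|+1)
symAt : ∀ {k} → List (Fin k) → ℕ → TSym k
symAt x        zero          = cent
symAt []       (suc zero)    = dollar
symAt []       (suc (suc i)) = dollar
symAt (a ∷ x)  (suc zero)    = sym a
symAt (a ∷ x)  (suc (suc i)) = symAt x (suc i)

data Dir : Set where
  left stay right : Dir

move : ℕ → Dir → Maybe ℕ
move zero    left  = nothing
move (suc i) left  = just i
move i       stay  = just i
move i       right = just (suc i)

record 2NPDA (k : ℕ) : Set where
  field
    nQ    : ℕ
    nΓ    : ℕ
    e     : ℕ
    q₀    : Fin nQ
    Z₀    : Fin nΓ
    acc   : Fin nQ → Bool
    rej   : Fin nQ → Bool
    -- δ p a Z q w d = true  iff  (q, w, d) ∈ δ(p, a, Z):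
    -- in state p reading a with Z on top, go to q, replace Z by w, move d
    δ     : Fin nQ → TSym k → Fin nΓ → Fin nQ → List (Fin nΓ) → Dir → Bool
    acc-rej-disjoint : ∀ q → acc q ≡ true → rej q ≡ true → ⊥
    halting-no-move  : ∀ p a Z q w d → (acc p ≡ true ⊎ rej p ≡ true) →
                       δ p a Z q w d ≡ false
    push-bound       : ∀ p a Z q w d → δ p a Z q w d ≡ true → length w ≤ e

module _ {k : ℕ} (M : 2NPDA k) where
  open 2NPDA M

  -- configuration: state, head position, stack (top = head of list)
  Config : Set
  Config = Fin nQ × ℕ × List (Fin nΓ)

  initConfig : Config
  initConfig = q₀ , 0 , (Z₀ ∷ [])

  data Step (x : List (Fin k)) : Config → Config → Set where
    step : ∀ {p i Z s q w d j} →
           δ p (symAt x i) Z q w d ≡ true →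
           move i d ≡ just j →
           j ≤ suc (length x) →
           Step x (p , i , Z ∷ s) (q , j , w ++ s)

  data Chain (x : List (Fin k)) : List Config → Set where
    single : ∀ c → Chain x (c ∷ [])
    cons   : ∀ {c c' cs} → Step x c c' → Chain x (c' ∷ cs) → Chain x (c ∷ c' ∷ cs)

  -- a (finite prefix of a) computation path of M on x
  CompPath : List (Fin k) → List Config → Set
  CompPath x cs = Σ Config λ c → Σ (List Config) λ rest →
                    (cs ≡ c ∷ rest) × (c ≡ initConfig) × Chain x cs

  AccPath : List (Fin k) → List Config → Set
  AccPath x cs = CompPath x cs ×
                 (Σ Config λ c → (last cs ≡ just c) × (acc (Data.Product.proj₁ c) ≡ true))

  Accepts : List (Fin k) → Set
  Accepts x = ∃ λ cs → AccPath x cs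

  TimeBounded : List (Fin k) → ℕ → Set
  TimeBounded x t = ∀ cs → CompPath x cs → length cs ≤ suc t

  UnambiguousOn : List (Fin k) → Set
  UnambiguousOn x = ∀ cs cs' → AccPath x cs → AccPath x cs' → cs ≡ cs'

-- |Γ^{≤e}| = Σ_{i=0}^{e} |Γ|^i
sumPow : ℕ → ℕ → ℕ
sumPow g zero    = 1
sumPow g (suc e) = sumPow g e + g ^ suc e

size : ∀ {k} → 2NPDA k → ℕ
size M = 2NPDA.nQ M * sumPow (2NPDA.nΓ M) (2NPDA.e M)

record PromiseFamily (k : ℕ) : Set₁ where
  field
    Lplus  : ℕ → List (Fin k) → Set
    Lminus : ℕ → List (Fin k) → Set
    disjoint : ∀ n x → Lplus n x → Lminus n x → ⊥

module _ {k : ℕ} (L : PromiseFamily k) where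
  open PromiseFamily L

  SolvesWithin : 2NPDA k → ℕ → (ℕ → ℕ) → Set
  SolvesWithin M n t =
    (∀ x → Lplus n x → Accepts M x × TimeBounded M x (t (length x))) ×
    (∀ x → Lminus n x → (Accepts M x → ⊥) × TimeBounded M x (t (length x)))

  UnambiguousFor : 2NPDA k → ℕ → Set
  UnambiguousFor M n = ∀ x → (Lplus n x ⊎ Lminus n x) → UnambiguousOn M x

  InPtime2NPD : Set
  InPtime2NPD = Σ (ℕ → 2NPDA k) λ M → Σ Poly λ s → Σ Poly2 λ p →
    ∀ n → size (M n) ≤ eval s n × SolvesWithin (M n) n (eval2 p n)

  InPtime2UPD : Set
  InPtime2UPD = Σ (ℕ → 2NPDA k) λ M → Σ Poly λ s → Σ Poly2 λ p →
    ∀ n → size (M n) ≤ eval s n × SolvesWithin (M n) n (eval2 p n) ×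
          UnambiguousFor (M n) n

  PolyCeiling : Set
  PolyCeiling = Σ Poly λ p → ∀ n x → (Lplus n x ⊎ Lminus n x) → length x ≤ eval p n

{-# OPTIONS --safe #-}

-- Non-uniform unambiguity by min-weight isolation and inductive counting (Reinhardt and Allender).
-- Whether M accepts x is a derivability question for polynomially many goals "from p, popping u leads
-- to q"; every goal also gets a failing derivation of weight B.  If all derivations of minimal weight
-- are unique, an unambiguous machine computes the minimal weights item by item: it guesses derivations
-- of all items below t on the stack and checks that their weights add up to the known sum S of the
-- minimal weights, which forces every guess to be the optimal one.  The accumulated costs of the
-- premises of t then give its minimal weight, and ties are noticed.  Finally x is accepted iff the last
-- item costs less than B.  Each weight choice for an item has at most one bad value per input, so
-- choosing the weights greedily leaves at most half of a set of inputs with ties; on all inputs of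
-- polynomial length one of polynomially many weight functions is tie-free, and the machine tries
-- them in turn.

module Submission where

open import Defs
open import Data.Nat
open import Data.Nat.Properties
open import Data.Nat.DivMod
open import Data.Nat.Tactic.RingSolver using (solve-∀)
open import Data.Nat.ListAction using (sum)
open import Data.Nat.ListAction.Properties using (sum-++)
open import Data.Bool using (Bool; true; false; if_then_else_)
open import Data.Bool.Properties using () renaming (_≟_ to _≟ᵇ_)
open import Data.Fin using (Fin; zero; suc; toℕ; fromℕ; fromℕ<; inject₁; remQuot; combine)
open import Data.Fin.Properties
  using (toℕ-injective; toℕ-fromℕ<; toℕ-fromℕ; toℕ<n; toℕ≤pred[n]; toℕ-inject₁; remQuot-combine; combine-remQuot)
  renaming (_≟_ to _≟ᶠ_)
open import Data.List using (List; []; _∷_; _++_; map; length; filter; last; lookup; concatMap; allFin; drop)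
import Data.List.Properties as ListP
open import Data.List.Properties
  using (map-++; ++-assoc; length-map; length-++; length-tabulate; map-injective)
open import Data.List.Relation.Unary.All using (All; []; _∷_)
import Data.List.Relation.Unary.All as All
import Data.List.Relation.Unary.All.Properties as AllP
import Data.List.Relation.Unary.Any as Any
open import Data.List.Relation.Unary.Any using (here; there)
open import Data.List.Relation.Unary.Any.Properties using (lookup-index)
open import Data.List.Membership.Propositional using (_∈_; lose; find)
open import Data.List.Membership.Propositional.Properties
  using (∈-filter⁺; ∈-map⁺; ∈-map⁻; ∈-++⁺ˡ; ∈-++⁺ʳ; ∈-++⁻; ∈-concatMap⁺; ∈-concatMap⁻; ∈-allFin; ∈-lookup)
import Data.List.Membership.DecPropositional as DecMembership
open import Data.Maybe using (Maybe; just; nothing)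
import Data.Maybe.Properties as MaybeP
open import Data.Vec using (Vec; []; _∷_) renaming (_++_ to _++ᵥ_)
import Data.Vec.Properties as VecP
open import Data.Vec.Relation.Unary.All using ([]; _∷_) renaming (All to AllV)
open import Data.Product using (Σ; _×_; _,_; ∃; ∃₂; proj₁; proj₂)
import Data.Product.Properties as ProductP
open import Data.Sum using (_⊎_; inj₁; inj₂)
open import Data.Unit using (⊤; tt)
open import Data.Empty using (⊥; ⊥-elim)
open import Function using (_∘_; id)
open import Function.Bundles using (_⇔_; mk⇔)
open import Relation.Binary.Definitions using (DecidableEquality; tri<; tri≈; tri>)
open import Relation.Nullary using (¬_; Dec; yes; no; does)
open import Relation.Nullary.Decidable using (_×-dec_; _⊎-dec_; dec-true; dec-false)
open import Relation.Unary using (Decidable)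
open import Relation.Binary.PropositionalEquality renaming (sym to symm)

-- Weighted systems and isolating weights

-- Isolation is arranged so that a tie is one equation in one unknown. Every item has just two
-- derivations: a default one of fixed weight, and an alternative one of adjustable weight `w t`,
-- usable if the symbol at `pos t` permits; a goal with many rules becomes a chain of such items.
-- Premises are smaller items, so once the weights below `t` are fixed, only `w t` is unknown in the
-- tie equation at `t`. Because of the failing derivations every item has a finite cost. A single
-- sum `S` therefore replaces the pair of count and sum known from inductive counting for
-- reachability. The stack serves one derivation at a time; the sum and the premise costs sit in the
-- finite control, which is affordable because all costs are polynomial. A tie at `t` is noticed in
-- the round of `t`, before any later round has to guess a derivation of `t`. Uniqueness of the
-- guesses thus never rests on an unchecked weight function. The ceiling leaves only singly
-- exponentially many inputs for each `n`, so polynomially many halvings exhaust them.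

record System (k : ℕ) : Set where
  field
    dweight  : ℕ → ℕ
    dprem    : ℕ → List ℕ
    aprem    : ℕ → List ℕ
    applies  : ℕ → TSym k → Bool
    pos      : ℕ → ℕ
    dweight>0 : ∀ t → 1 ≤ dweight t
    dprem<   : ∀ t → All (_< t) (dprem t)
    aprem<   : ∀ t → All (_< t) (aprem t)
    dprem≤2  : ∀ t → length (dprem t) ≤ 2
    aprem≤2  : ∀ t → length (aprem t) ≤ 2

pick : Bool → ℕ → ℕ → ℕ
pick false a b = a
pick true  a b = a ⊓ b

pick≤ : ∀ r a b → pick r a b ≤ a
pick≤ false a b = ≤-refl
pick≤ true  a b = m⊓n≤m a b

module Costs {k : ℕ} (Y : System k) (x : List (Fin k)) where
  open System Y

  ready : ℕ → Bool
  ready t = applies t (symAt x (pos t))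

  module _ (w : ℕ → ℕ) where
    -- Fuel stands in for well-founded recursion on the premises: they are smaller than the item, so
    -- every fuel above `t` gives the same value at `t`.
    costF : ℕ → ℕ → ℕ
    costF zero    t = 0
    costF (suc f) t = pick (ready t) (dweight t + sum (map (costF f) (dprem t)))
                                     (w t + sum (map (costF f) (aprem t)))

    cost : ℕ → ℕ
    cost t = costF (suc t) t

    total : List ℕ → ℕ
    total ps = sum (map cost ps)

    dcost acost : ℕ → ℕ
    dcost t = dweight t + total (dprem t)
    acost t = w t + total (aprem t)

    Tied : ℕ → Set
    Tied t = ready t ≡ true × dcost t ≡ acost t

    Tied? : Decidable Tied
    Tied? t = (ready t ≟ᵇ true) ×-dec (dcost t ≟ acost t)

    TiedBelow : ℕ → Set
    TiedBelow n = ∃ λ t → t < n × Tied t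

    TiedBelow? : Decidable TiedBelow
    TiedBelow? = anyUpTo? Tied?

  sum-map-local : ∀ {f g : ℕ → ℕ} {t} ps → All (_< t) ps → (∀ p → p < t → f p ≡ g p) →
                  sum (map f ps) ≡ sum (map g ps)
  sum-map-local [] [] e = refl
  sum-map-local (p ∷ ps) (a ∷ as) e = cong₂ _+_ (e p a) (sum-map-local ps as e)

  costF-local : ∀ {w w′} f f′ t → t < f → t < f′ → (∀ s → s ≤ t → w s ≡ w′ s) →
                costF w f t ≡ costF w′ f′ t
  costF-local {w} {w′} (suc f) (suc f′) t (s≤s t≤f) (s≤s t≤f′) e =
    cong₂ (pick (ready t))
      (cong (dweight t +_) (sum-map-local (dprem t) (dprem< t) below))
      (cong₂ _+_ (e t ≤-refl) (sum-map-local (aprem t) (aprem< t) below))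
    where
      below : ∀ p → p < t → costF w f p ≡ costF w′ f′ p
      below p p<t = costF-local f f′ p (<-≤-trans p<t t≤f) (<-≤-trans p<t t≤f′)
                      λ s s≤p → e s (≤-trans s≤p (<⇒≤ p<t))

  -- What makes a greedy choice possible: changing `w` at `n` leaves the costs of all items below
  -- `n` alone.
  cost-local : ∀ {w w′} t → (∀ s → s ≤ t → w s ≡ w′ s) → cost w t ≡ cost w′ t
  cost-local t e = costF-local (suc t) (suc t) t ≤-refl ≤-refl e

  total-local : ∀ {w w′} {t} ps → All (_< t) ps → (∀ s → s < t → w s ≡ w′ s) →
                total w ps ≡ total w′ ps
  total-local ps as e =
    sum-map-local ps as λ p p<t → cost-local p λ s s≤p → e s (≤-<-trans s≤p p<t)

  cost-≡ : ∀ w t → cost w t ≡ pick (ready t) (dcost w t) (acost w t)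
  cost-≡ w t = cong₂ (λ a b → pick (ready t) (dweight t + a) (w t + b))
    (sum-map-local (dprem t) (dprem< t) below) (sum-map-local (aprem t) (aprem< t) below)
    where
      below : ∀ p → p < t → costF w t p ≡ cost w p
      below p p<t = costF-local t (suc p) p p<t ≤-refl λ _ _ → refl

  Tied-local : ∀ {w w′} t → (∀ s → s ≤ t → w s ≡ w′ s) → Tied w t → Tied w′ t
  Tied-local t e (r , q) = r ,
    trans (symm (cong (dweight t +_) (total-local (dprem t) (dprem< t) e<)))
      (trans q (cong₂ _+_ (e t ≤-refl) (total-local (aprem t) (aprem< t) e<)))
    where e< = λ s s<t → e s (<⇒≤ s<t)

-- Counting and averaging

module _ {a} {A : Set a} where

  count : ∀ {p} {P : A → Set p} → Decidable P → List A → ℕ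
  count P? xs = length (filter P? xs)

  count-∷ : ∀ {p} {P : A → Set p} (P? : Decidable P) x xs →
            count P? (x ∷ xs) ≡ (if does (P? x) then 1 else 0) + count P? xs
  count-∷ P? x xs with does (P? x)
  ... | true  = refl
  ... | false = refl

  count-⊎ : ∀ {p q r} {P : A → Set p} {Q : A → Set q} {R : A → Set r}
            (P? : Decidable P) (Q? : Decidable Q) (R? : Decidable R) →
            (∀ {x} → P x → Q x ⊎ R x) → ∀ xs → count P? xs ≤ count Q? xs + count R? xs
  count-⊎ P? Q? R? imp [] = z≤n
  count-⊎ P? Q? R? imp (x ∷ xs)
    rewrite count-∷ P? x xs | count-∷ Q? x xs | count-∷ R? x xs =
    ≤-trans (+-mono-≤ pt (count-⊎ P? Q? R? imp xs)) (≤-reflexive (lem (δ (Q? x)) (δ (R? x)) _ _))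
    where
      δ : ∀ {s} {S : Set s} → Dec S → ℕ
      δ d = if does d then 1 else 0
      lem : ∀ a b c d → (a + b) + (c + d) ≡ (a + c) + (b + d)
      lem = solve-∀
      pt : δ (P? x) ≤ δ (Q? x) + δ (R? x)
      pt with P? x | Q? x | R? x
      ... | no _  | _     | _     = z≤n
      ... | yes _ | yes _ | _     = s≤s z≤n
      ... | yes _ | no _  | yes _ = ≤-refl
      ... | yes p | no ¬q | no ¬r with imp p
      ... | inj₁ q = ⊥-elim (¬q q)
      ... | inj₂ r = ⊥-elim (¬r r)

Σ< : ℕ → (ℕ → ℕ) → ℕ
Σ< zero    f = 0
Σ< (suc n) f = f n + Σ< n f

Σ<-+ : ∀ n f g → Σ< n (λ i → f i + g i) ≡ Σ< n f + Σ< n g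
Σ<-+ zero f g = refl
Σ<-+ (suc n) f g rewrite Σ<-+ n f g = lem (f n) (g n) _ _
  where
    lem : ∀ a b c d → (a + b) + (c + d) ≡ (a + c) + (b + d)
    lem = solve-∀

Σ<-cong : ∀ n {f g} → (∀ i → i < n → f i ≡ g i) → Σ< n f ≡ Σ< n g
Σ<-cong zero e = refl
Σ<-cong (suc n) e = cong₂ _+_ (e n ≤-refl) (Σ<-cong n λ i i<n → e i (m≤n⇒m≤1+n i<n))

Σ<-zero : ∀ n → Σ< n (λ _ → 0) ≡ 0
Σ<-zero zero = refl
Σ<-zero (suc n) = Σ<-zero n

Σ<-indicator-0 : ∀ n {a} (f : ℕ → ℕ) → n ≤ a → Σ< n (λ i → if does (a ≟ i) then f i else 0) ≡ 0
Σ<-indicator-0 zero f n≤a = refl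
Σ<-indicator-0 (suc n) {a} f n<a with a ≟ n
... | yes refl = ⊥-elim (<-irrefl refl n<a)
... | no a≢n rewrite dec-false (a ≟ n) a≢n = Σ<-indicator-0 n f (<⇒≤ n<a)

Σ<-indicator : ∀ n {a} (f : ℕ → ℕ) → a < n → Σ< n (λ i → if does (a ≟ i) then f i else 0) ≡ f a
Σ<-indicator (suc n) {a} f (s≤s a≤n) with a ≟ n
... | yes refl rewrite dec-true (n ≟ n) refl | Σ<-indicator-0 n f (≤-refl {n}) = +-identityʳ (f n)
... | no a≢n rewrite dec-false (a ≟ n) a≢n = Σ<-indicator n f (≤∧≢⇒< a≤n a≢n)

Σ<-indicator-≤1 : ∀ n a → Σ< n (λ i → if does (a ≟ i) then 1 else 0) ≤ 1
Σ<-indicator-≤1 n a with a <? n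
... | yes a<n = ≤-reflexive (Σ<-indicator n (λ _ → 1) a<n)
... | no  a≮n = ≤-trans (≤-reflexive (Σ<-indicator-0 n (λ _ → 1) (≮⇒≥ a≮n))) z≤n

-- Each element has one value under `g` and so is counted for at most one `v`.
Σ<-count : ∀ {a} {A : Set a} (g : A → ℕ) n xs → Σ< n (λ v → count (λ x → g x ≟ v) xs) ≤ length xs
Σ<-count g n [] = ≤-reflexive (Σ<-zero n)
Σ<-count g n (x ∷ xs) = begin
  Σ< n (λ v → count (λ y → g y ≟ v) (x ∷ xs))
    ≡⟨ Σ<-cong n (λ v _ → count-∷ (λ y → g y ≟ v) x xs) ⟩
  Σ< n (λ v → (if does (g x ≟ v) then 1 else 0) + count (λ y → g y ≟ v) xs)
    ≡⟨ Σ<-+ n _ _ ⟩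
  Σ< n (λ v → if does (g x ≟ v) then 1 else 0) + Σ< n (λ v → count (λ y → g y ≟ v) xs)
    ≤⟨ +-mono-≤ (Σ<-indicator-≤1 n (g x)) (Σ<-count g n xs) ⟩
  suc (length xs) ∎
  where open ≤-Reasoning

min≤average : ∀ n (f : ℕ → ℕ) → ∃ λ v → v < suc n × suc n * f v ≤ Σ< (suc n) f
min≤average zero f = 0 , s≤s z≤n , ≤-refl
min≤average (suc n) f with min≤average n f
... | v , v<n , le with ≤-total (f (suc n)) (f v)
... | inj₁ new = suc n , ≤-refl , +-monoʳ-≤ (f (suc n)) (≤-trans (*-monoʳ-≤ (suc n) new) le)
... | inj₂ old = v , m≤n⇒m≤1+n v<n , +-mono-≤ old le

module Weights {k : ℕ} (Y : System k) where
  open System Y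
  open Costs Y

  update : (ℕ → ℕ) → ℕ → ℕ → ℕ → ℕ
  update w t v s = if does (s ≟ t) then v else w s

  update-≡ : ∀ w t v → update w t v t ≡ v
  update-≡ w t v rewrite dec-true (t ≟ t) refl = refl

  update-< : ∀ w t v s → s < t → update w t v s ≡ w s
  update-< w t v s s<t rewrite dec-false (s ≟ t) (<⇒≢ s<t) = refl

  update-bound : ∀ {V} w t v → (∀ s → 1 ≤ w s × w s ≤ V) → v < V →
                 ∀ s → 1 ≤ update w t (suc v) s × update w t (suc v) s ≤ V
  update-bound w t v wb v<V s with does (s ≟ t)
  ... | true  = s≤s z≤n , v<V
  ... | false = wb s

  -- Given the weights below t, a single value of w t ties item t on input x.
  few-ties : ∀ V′ (X : List (List (Fin k))) n → Σ (ℕ → ℕ) λ w → (∀ t → 1 ≤ w t × w t ≤ suc V′) ×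
             suc V′ * count (λ x → TiedBelow? x w n) X ≤ n * length X
  few-ties V′ X zero = (λ _ → 1) , (λ _ → ≤-refl , s≤s z≤n) ,
    ≤-reflexive (trans (cong (suc V′ *_) (none X)) (*-zeroʳ (suc V′)))
    where
      none : ∀ X → count (λ x → TiedBelow? x (λ _ → 1) 0) X ≡ 0
      none [] = refl
      none (x ∷ X) = none X
  few-ties V′ X (suc n) with few-ties V′ X n
  ... | w , wb , le = w′ , update-bound w n v wb v<V , (begin
      V * count (λ x → TiedBelow? x w′ (suc n)) X
        ≤⟨ *-monoʳ-≤ V (count-⊎ (λ x → TiedBelow? x w′ (suc n)) (λ x → TiedBelow? x w n) (λ x → forbidden x ≟ v) (λ {x} → split {x}) X) ⟩
      V * (count (λ x → TiedBelow? x w n) X + count (λ x → forbidden x ≟ v) X)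
        ≡⟨ *-distribˡ-+ V (count (λ x → TiedBelow? x w n) X) _ ⟩
      V * count (λ x → TiedBelow? x w n) X + V * count (λ x → forbidden x ≟ v) X
        ≤⟨ +-mono-≤ le (≤-trans v-min (Σ<-count forbidden V X)) ⟩
      n * length X + length X
        ≡⟨ +-comm (n * length X) (length X) ⟩
      suc n * length X ∎)
    where
      open ≤-Reasoning
      V = suc V′
      forbidden : List (Fin k) → ℕ
      -- Weights are positive: `v` stands for the weight `suc v`, hence the `pred`. Where the
      -- difference is not positive, 0 is forbidden without need, which only overcounts the ties.
      forbidden x = pred (dcost x w n ∸ total x w (aprem n))
      choice = min≤average V′ (λ v → count (λ x → forbidden x ≟ v) X)
      v = proj₁ choice
      v<V = proj₁ (proj₂ choice)
      v-min = proj₂ (proj₂ choice)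
      w′ = update w n (suc v)
      split : ∀ {x} → TiedBelow x w′ (suc n) → TiedBelow x w n ⊎ forbidden x ≡ v
      split {x} (t , s≤s t≤n , ti) with t ≟ n
      ... | no t≢n = inj₁ (t , t<n , Tied-local x t (λ s s≤t → update-< w n (suc v) s (≤-<-trans s≤t t<n)) ti)
        where t<n = ≤∧≢⇒< t≤n t≢n
      ... | yes refl = inj₂ (cong pred
              (trans (cong (_∸ total x w (aprem n)) eq) (m+n∸n≡m (suc v) (total x w (aprem n)))))
        where
          same : ∀ s → s < n → w′ s ≡ w s
          same s = update-< w n (suc v) s
          eq : dcost x w n ≡ suc v + total x w (aprem n)
          eq = trans (symm (cong (dweight n +_) (total-local x (dprem n) (dprem< n) same)))
                (trans (proj₂ ti) (cong₂ _+_ (update-≡ w n (suc v)) (total-local x (aprem n) (aprem< n) same)))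

  -- Origin of the weight range `suc (2 * N)`: if each of `N` items spoils at most a fraction
  -- 1/(2N+1) of the inputs, then together they spoil at most half.
  half : ∀ N b l → suc (2 * N) * b ≤ N * l → 2 * b ≤ l
  half zero    b l le = ≤-trans (≤-reflexive (cong (2 *_) b≡0)) z≤n
    where b≡0 = n≤0⇒n≡0 (≤-trans (m≤m+n b 0) le)
  half (suc N) b l le = *-cancelˡ-≤ (suc N) (begin
    suc N * (2 * b)       ≡⟨ lem (suc N) b ⟩
    2 * suc N * b         ≤⟨ m≤n+m _ b ⟩
    suc (2 * suc N) * b   ≤⟨ le ⟩
    suc N * l             ∎)
    where
      open ≤-Reasoning
      lem : ∀ n l → n * (2 * l) ≡ 2 * n * l
      lem = solve-∀

  isolating-family : ∀ N I (X : List (List (Fin k))) → length X < 2 ^ I →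
    Σ (ℕ → ℕ → ℕ) λ w → (∀ i t → 1 ≤ w i t × w i t ≤ suc (2 * N)) ×
      (∀ x → x ∈ X → ∃ λ i → i ≤ I × ¬ TiedBelow x (w i) N)
  isolating-family N zero [] _ = (λ _ _ → 1) , (λ _ _ → ≤-refl , s≤s z≤n) , λ _ ()
  isolating-family N zero (_ ∷ _) (s≤s ())
  isolating-family N (suc I) X X<2^I with few-ties (2 * N) X N
  ... | w₀ , w₀b , le with isolating-family N I X′ X′<2^I
    where
      X′ = filter (λ x → TiedBelow? x w₀ N) X
      X′<2^I : length X′ < 2 ^ I
      X′<2^I = *-cancelˡ-< 2 _ _ (≤-<-trans (half N (length X′) (length X) le) X<2^I)
  ... | w , wb , good = W , Wb , G
    where
      W : ℕ → ℕ → ℕ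
      W zero    = w₀
      W (suc i) = w i
      Wb : ∀ i t → 1 ≤ W i t × W i t ≤ suc (2 * N)
      Wb zero    = w₀b
      Wb (suc i) = wb i
      G : ∀ x → x ∈ X → ∃ λ i → i ≤ suc I × ¬ TiedBelow x (W i) N
      G x x∈X with TiedBelow? x w₀ N
      ... | no ¬t = 0 , z≤n , ¬t
      ... | yes t with good x (∈-filter⁺ (λ x → TiedBelow? x w₀ N) x∈X t)
      ... | i , i≤I , ¬t = suc i , s≤s i≤I , ¬t

-- The search program

dollar? : ∀ {k} (a : TSym k) → Dec (a ≡ dollar)
dollar? cent    = no λ ()
dollar? dollar  = yes refl
dollar? (TSym.sym _) = no λ ()

symAt-dollar : ∀ {k} (x : List (Fin k)) i j → symAt x i ≡ dollar → i ≤ j → symAt x j ≡ dollar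
symAt-dollar x zero j () i≤j
symAt-dollar []      (suc i) (suc zero)    eq i≤j = refl
symAt-dollar []      (suc i) (suc (suc j)) eq i≤j = refl
symAt-dollar (a ∷ x) (suc zero) j () i≤j
symAt-dollar (a ∷ x) (suc (suc i)) (suc (suc j)) eq (s≤s i≤j) = symAt-dollar x (suc i) (suc j) eq i≤j

symAt-inside : ∀ {k} (x : List (Fin k)) i → symAt x i ≢ dollar → i ≤ length x
symAt-inside x zero ne = z≤n
symAt-inside [] (suc zero) ne = ⊥-elim (ne refl)
symAt-inside [] (suc (suc i)) ne = ⊥-elim (ne refl)
symAt-inside (a ∷ x) (suc zero) ne = s≤s z≤n
symAt-inside (a ∷ x) (suc (suc i)) ne = s≤s (symAt-inside x (suc i) ne)

move-stay : ∀ c → move c stay ≡ just c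
move-stay zero    = refl
move-stay (suc c) = refl

move-right : ∀ c → move c right ≡ just (suc c)
move-right zero    = refl
move-right (suc c) = refl

multiplicity : ℕ → List ℕ → ℕ
multiplicity h = count (_≟ h)

-- New registers, pushed word, move. The registers are the numeric fields of `Search` in their
-- order, and `nothing` is the accepting state. On the stack, 0 marks the bottom and `suc g` is a
-- pending item `g`.
Action : Set
Action = Maybe (Vec ℕ 8) × List ℕ × Dir

-- Item [target] is being evaluated with the weights of index [family]; the items below [current] and
-- those on the agenda are still to be derived, at a total weight of [budget] - [spent].
record Search : Set where
  constructor search
  field
    head family target current spent cost₀ cost₁ budget : ℕ
    agenda : List ℕ

module Program {k : ℕ} (Y : System k) (w : ℕ → ℕ → ℕ) (M B : ℕ) where
  open System Y

  rules : ℕ → ℕ → TSym k → List (ℕ × List ℕ)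
  rules i g a = (dweight g , dprem g) ∷ (if applies g a then (w i g , aprem g) ∷ [] else [])

  module _ (c i t S b₀ b₁ : ℕ) (r : Bool) where
    -- If `t ≡ M` and the cost is not below `B`, no constructor applies: the search is stuck and
    -- does not accept.
    data Finish : Maybe (Vec ℕ 8) → Set where
      restart : r ≡ true → b₀ ≡ b₁ →
                Finish (just (c ∷ suc i ∷ 0 ∷ 0 ∷ 0 ∷ 0 ∷ 0 ∷ 0 ∷ []))
      advance : ¬ (r ≡ true × b₀ ≡ b₁) → t ≢ M →
                Finish (just (c ∷ i ∷ suc t ∷ suc t ∷ 0 ∷ 0 ∷ 0 ∷ S + pick r b₀ b₁ ∷ []))
      accept  : ¬ (r ≡ true × b₀ ≡ b₁) → t ≡ M → pick r b₀ b₁ < B → Finish nothing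

    finishBy : Dec (r ≡ true × b₀ ≡ b₁) → Dec (t ≡ M) → Dec (pick r b₀ b₁ < B) → List (Maybe (Vec ℕ 8))
    finishBy (yes _) _ _ = just (c ∷ suc i ∷ 0 ∷ 0 ∷ 0 ∷ 0 ∷ 0 ∷ 0 ∷ []) ∷ []
    finishBy (no _) (no _) _ = just (c ∷ i ∷ suc t ∷ suc t ∷ 0 ∷ 0 ∷ 0 ∷ S + pick r b₀ b₁ ∷ []) ∷ []
    finishBy (no _) (yes _) (yes _) = nothing ∷ []
    finishBy (no _) (yes _) (no _) = []

    finish : List (Maybe (Vec ℕ 8))
    finish = finishBy ((r ≟ᵇ true) ×-dec (b₀ ≟ b₁)) (t ≟ M) (pick r b₀ b₁ <? B)

    finishBy⁻ : ∀ {st} p q u → st ∈ finishBy p q u → Finish st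
    finishBy⁻ (yes (r≡ , b≡)) q u (here refl) = restart r≡ b≡
    finishBy⁻ (no ¬p) (no ¬q) u (here refl) = advance ¬p ¬q
    finishBy⁻ (no ¬p) (yes q) (yes u) (here refl) = accept ¬p q u

    finishBy⁺ : ∀ {st} p q u → Finish st → st ∈ finishBy p q u
    finishBy⁺ (yes _) q u (restart _ _) = here refl
    finishBy⁺ (no ¬p) q u (restart r≡ b≡) = ⊥-elim (¬p (r≡ , b≡))
    finishBy⁺ (yes p) q u (advance ¬p _) = ⊥-elim (¬p p)
    finishBy⁺ (no _) (yes q) u (advance _ ¬q) = ⊥-elim (¬q q)
    finishBy⁺ (no _) (no _) u (advance _ _) = here refl
    finishBy⁺ (yes p) q u (accept ¬p _ _) = ⊥-elim (¬p p)
    finishBy⁺ (no _) (no ¬q) u (accept _ q _) = ⊥-elim (¬q q)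
    finishBy⁺ (no _) (yes _) (no ¬u) (accept _ _ u) = ⊥-elim (¬u u)
    finishBy⁺ (no _) (yes _) (yes _) (accept _ _ _) = here refl

    finish⁻ : ∀ {st} → st ∈ finish → Finish st
    finish⁻ = finishBy⁻ _ _ _

    finish⁺ : ∀ {st} → Finish st → st ∈ finish
    finish⁺ = finishBy⁺ _ _ _

  module _ (c i t h s c₀ c₁ S : ℕ) (a : TSym k) where
    -- The premise costs of `t` are not stored one by one. Each node in the derivation of `h` pays
    -- its weight into an accumulator as often as `h` occurs among the respective premises of `t`.
    choose : ℕ → ℕ × List ℕ → Action
    choose g (wt , ps) =
      just (c ∷ i ∷ t ∷ h ∷ s + wt ∷ c₀ + multiplicity h (dprem t) * wt
              ∷ c₁ + multiplicity h (aprem t) * wt ∷ S ∷ []) ,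
      map suc ps , stay

    conclude : Dec (s ≡ S) → List Action
    conclude (yes _) = map (λ st → st , 0 ∷ [] , stay)
                           (finish c i t S (dweight t + c₀) (w i t + c₁) (applies t a))
    conclude (no _)  = []

  act : (c i t h s c₀ c₁ S : ℕ) → TSym k → ℕ → List Action
  act c i t h       s c₀ c₁ S a (suc g) = map (choose c i t h s c₀ c₁ S a g) (rules i g a)
  act c i t (suc h) s c₀ c₁ S a zero    =
    (just (c ∷ i ∷ t ∷ h ∷ s ∷ c₀ ∷ c₁ ∷ S ∷ []) , suc h ∷ 0 ∷ [] , stay) ∷ []
  act c i t zero    s c₀ c₁ S a zero    = conclude c i t zero s c₀ c₁ S a (s ≟ S)

  -- With no item pending the head goes to `pos t`, where settling needs the symbol that decides
  -- whether the alternative of `t` applies.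
  address : ℕ → ℕ → ℕ
  address t zero    = pos t
  address t (suc g) = pos g

  seek : (c i t h s c₀ c₁ S : ℕ) (a : TSym k) (z : ℕ) →
         Dec (address t z < c) → Dec (c < address t z) → Dec (a ≡ dollar) → List Action
  seek c i t h s c₀ c₁ S a z (yes _) _ _ =
    (just (pred c ∷ i ∷ t ∷ h ∷ s ∷ c₀ ∷ c₁ ∷ S ∷ []) , z ∷ [] , left) ∷ []
  seek c i t h s c₀ c₁ S a z (no _) (yes _) (no _) =
    (just (suc c ∷ i ∷ t ∷ h ∷ s ∷ c₀ ∷ c₁ ∷ S ∷ []) , z ∷ [] , right) ∷ []
  seek c i t h s c₀ c₁ S a z (no _) (yes _) (yes _) = act c i t h s c₀ c₁ S a z
  seek c i t h s c₀ c₁ S a z (no _) (no _) _ = act c i t h s c₀ c₁ S a z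

  actions : Maybe (Vec ℕ 8) → TSym k → ℕ → List Action
  actions nothing a z = []
  actions (just (c ∷ i ∷ t ∷ h ∷ s ∷ c₀ ∷ c₁ ∷ S ∷ [])) a z =
    seek c i t h s c₀ c₁ S a z (address t z <? c) (c <? address t z) (dollar? a)

  Config′ : Set
  Config′ = Maybe (Vec ℕ 8) × ℕ × List ℕ

  data SConfig : Set where
    running  : Search → SConfig
    accepted : ℕ → SConfig

  -- The shape of all configurations that occur: the agenda over one bottom marker, and the head
  -- position copied into the state, because a finite control cannot see where the head is.
  embed : SConfig → Config′
  embed (running (search c i t h s c₀ c₁ S gs)) =
    just (c ∷ i ∷ t ∷ h ∷ s ∷ c₀ ∷ c₁ ∷ S ∷ []) , c , map suc gs ++ 0 ∷ []
  embed (accepted c) = nothing , c , 0 ∷ []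

  goal : ℕ → List ℕ → ℕ
  goal t []      = pos t
  goal t (g ∷ _) = pos g

  module Semantics (x : List (Fin k)) where
    open Costs Y x

    -- An address may lie beyond the right endmarker. Standing on `dollar` is then good enough,
    -- since `symAt` continues with `dollar` there.
    Arrived : ℕ → ℕ → Set
    Arrived c p = ¬ (p < c) × (c < p → symAt x c ≡ dollar)

    arrived-reads : ∀ {c p} → Arrived c p → symAt x c ≡ symAt x p
    arrived-reads {c} {p} (¬< , ≤) with <-cmp c p
    ... | tri< c<p _ _ = trans (≤ c<p) (symm (symAt-dollar x c p (≤ c<p) (<⇒≤ c<p)))
    ... | tri≈ _ refl _ = refl
    ... | tri> _ _ p<c = ⊥-elim (¬< p<c)

    resume : ℕ → Maybe (Vec ℕ 8) → SConfig
    resume c nothing = accepted c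
    resume _ (just (c ∷ i ∷ t ∷ h ∷ s ∷ c₀ ∷ c₁ ∷ S ∷ [])) = running (search c i t h s c₀ c₁ S [])

    data SStep : SConfig → SConfig → Set where
      seekˡ : ∀ {c i t h s c₀ c₁ S gs} → goal t gs < suc c →
        SStep (running (search (suc c) i t h s c₀ c₁ S gs)) (running (search c i t h s c₀ c₁ S gs))
      seekʳ : ∀ {c i t h s c₀ c₁ S gs} → c < goal t gs → symAt x c ≢ dollar →
        SStep (running (search c i t h s c₀ c₁ S gs)) (running (search (suc c) i t h s c₀ c₁ S gs))
      derive : ∀ {c i t h s c₀ c₁ S g gs wt ps} → Arrived c (pos g) →
        (wt , ps) ∈ rules i g (symAt x (pos g)) →
        SStep (running (search c i t h s c₀ c₁ S (g ∷ gs)))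
              (running (search c i t h (s + wt) (c₀ + multiplicity h (dprem t) * wt)
                                (c₁ + multiplicity h (aprem t) * wt) S (ps ++ gs)))
      descend : ∀ {c i t h s c₀ c₁ S} → Arrived c (pos t) →
        SStep (running (search c i t (suc h) s c₀ c₁ S []))
              (running (search c i t h s c₀ c₁ S (h ∷ [])))
      settle : ∀ {c i t s c₀ c₁ S st} → Arrived c (pos t) → s ≡ S →
        Finish c i t S (dweight t + c₀) (w i t + c₁) (ready t) st →
        SStep (running (search c i t zero s c₀ c₁ S [])) (resume c st)

    stack-++ : ∀ ps gs → map suc (ps ++ gs) ++ 0 ∷ [] ≡ map suc ps ++ map suc gs ++ 0 ∷ []
    stack-++ ps gs = trans (cong (_++ 0 ∷ []) (map-++ suc ps gs)) (++-assoc (map suc ps) _ _)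

    embed-finish : ∀ {c i t S b₀ b₁ r st} → Finish c i t S b₀ b₁ r st →
                   embed (resume c st) ≡ (st , c , 0 ∷ [])
    embed-finish (restart _ _)  = refl
    embed-finish (advance _ _)  = refl
    embed-finish (accept _ _ _) = refl

    act⁻ : ∀ c i t h s c₀ c₁ S gs {z zs st ws d j} → map suc gs ++ 0 ∷ [] ≡ z ∷ zs →
      Arrived c (goal t gs) → (st , ws , d) ∈ act c i t h s c₀ c₁ S (symAt x c) z → move c d ≡ just j →
      ∃ λ σ → embed σ ≡ (st , j , ws ++ zs) × SStep (running (search c i t h s c₀ c₁ S gs)) σ
    act⁻ c i t (suc h) s c₀ c₁ S [] refl arr (here refl) mv
      with refl ← trans (symm (move-stay c)) mv = _ , refl , descend arr
    act⁻ c i t zero s c₀ c₁ S [] refl arr m mv with s ≟ S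
    ... | yes s≡S with _ , st∈ , refl ← ∈-map⁻ _ m with refl ← trans (symm (move-stay c)) mv =
      _ , embed-finish f , settle arr s≡S f
      where f = subst (λ a → Finish c i t S _ _ (applies t a) _) (arrived-reads arr) (finish⁻ _ _ _ _ _ _ _ st∈)
    act⁻ c i t h s c₀ c₁ S (g ∷ gs) refl arr m mv
      with (wt , ps) , r∈ , refl ← ∈-map⁻ _ m
      with refl ← trans (symm (move-stay c)) mv =
      _ , cong (λ u → _ , _ , u) (stack-++ ps gs) ,
      derive arr (subst (λ a → (wt , ps) ∈ rules i g a) (arrived-reads arr) r∈)

    address-goal : ∀ t gs {z zs} → map suc gs ++ 0 ∷ [] ≡ z ∷ zs → address t z ≡ goal t gs
    address-goal t []       refl = refl
    address-goal t (g ∷ gs) refl = refl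

    -- The program with unbounded registers and items; the automaton is its restriction to bounded
    -- ones.
    data AStep : Config′ → Config′ → Set where
      astep : ∀ {st p z zs st′ ws d j} → (st′ , ws , d) ∈ actions st (symAt x p) z →
              move p d ≡ just j → j ≤ suc (length x) → AStep (st , p , z ∷ zs) (st′ , j , ws ++ zs)

    astep⁻ : ∀ σ {a a′} → embed σ ≡ a → AStep a a′ → ∃ λ σ′ → embed σ′ ≡ a′ × SStep σ σ′
    astep⁻ (accepted c) refl (astep () _ _)
    astep⁻ (running (search c i t h s c₀ c₁ S gs)) eq (astep {z = z} {zs} m mv _)
      with refl ← cong proj₁ eq | refl ← cong (proj₁ ∘ proj₂) eq | e ← cong (proj₂ ∘ proj₂) eq
      with address t z <? c | c <? address t z | dollar? (symAt x c)
    astep⁻ (running (search (suc c) i t h s c₀ c₁ S gs)) eq (astep (here refl) refl _) | yes lt | _ | _ =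
      _ , cong (λ u → _ , _ , u) e , seekˡ (subst (_< suc c) (address-goal t gs e) lt)
    astep⁻ (running (search c i t h s c₀ c₁ S gs)) eq (astep (here refl) mv _) | no _ | yes lt | no ne
      with refl ← trans (symm (move-right c)) mv =
      _ , cong (λ u → _ , _ , u) e , seekʳ (subst (c <_) (address-goal t gs e) lt) ne
    ... | no ¬lt | yes _ | yes d = act⁻ c i t h s c₀ c₁ S gs e
        (subst (Arrived c) (address-goal t gs e) (¬lt , λ _ → d)) m mv
    ... | no ¬lt | no ¬gt | _ = act⁻ c i t h s c₀ c₁ S gs e
        (subst (Arrived c) (address-goal t gs e) (¬lt , λ gt → ⊥-elim (¬gt gt))) m mv

    headOf : SConfig → ℕ
    headOf (running r)  = Search.head r
    headOf (accepted c) = c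

    seek-act : ∀ c i t h s c₀ c₁ S z {α} → Arrived c (address t z) →
      α ∈ act c i t h s c₀ c₁ S (symAt x c) z →
      α ∈ actions (just (c ∷ i ∷ t ∷ h ∷ s ∷ c₀ ∷ c₁ ∷ S ∷ [])) (symAt x c) z
    seek-act c i t h s c₀ c₁ S z (¬lt , d) m with address t z <? c | c <? address t z | dollar? (symAt x c)
    ... | yes lt | _ | _ = ⊥-elim (¬lt lt)
    ... | no _ | yes gt | no ne = ⊥-elim (ne (d gt))
    ... | no _ | yes _ | yes _ = m
    ... | no _ | no _ | _ = m

    seek-left : ∀ c i t h s c₀ c₁ S z → address t z < suc c →
      (just (c ∷ i ∷ t ∷ h ∷ s ∷ c₀ ∷ c₁ ∷ S ∷ []) , z ∷ [] , left) ∈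
      actions (just (suc c ∷ i ∷ t ∷ h ∷ s ∷ c₀ ∷ c₁ ∷ S ∷ [])) (symAt x (suc c)) z
    seek-left c i t h s c₀ c₁ S z lt
      with address t z <? suc c | suc c <? address t z | dollar? (symAt x (suc c))
    ... | yes _ | _ | _ = here refl
    ... | no ¬lt | _ | _ = ⊥-elim (¬lt lt)

    seek-right : ∀ c i t h s c₀ c₁ S z → c < address t z → symAt x c ≢ dollar →
      (just (suc c ∷ i ∷ t ∷ h ∷ s ∷ c₀ ∷ c₁ ∷ S ∷ []) , z ∷ [] , right) ∈
      actions (just (c ∷ i ∷ t ∷ h ∷ s ∷ c₀ ∷ c₁ ∷ S ∷ [])) (symAt x c) z
    seek-right c i t h s c₀ c₁ S z gt ne
      with address t z <? c | c <? address t z | dollar? (symAt x c)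
    ... | yes lt | _ | _ = ⊥-elim (<-asym lt gt)
    ... | no _ | no ¬gt | _ = ⊥-elim (¬gt gt)
    ... | no _ | yes _ | yes d = ⊥-elim (ne d)
    ... | no _ | yes _ | no _ = here refl

    astep⁺ : ∀ {σ σ′} → SStep σ σ′ → headOf σ ≤ suc (length x) → AStep (embed σ) (embed σ′)
    astep⁺ (seekˡ {gs = []} lt) le = astep (seek-left _ _ _ _ _ _ _ _ 0 lt) refl (<⇒≤ le)
    astep⁺ (seekˡ {gs = g ∷ gs} lt) le = astep (seek-left _ _ _ _ _ _ _ _ (suc g) lt) refl (<⇒≤ le)
    astep⁺ (seekʳ {c} {gs = []} gt ne) le =
      astep (seek-right _ _ _ _ _ _ _ _ 0 gt ne) (move-right c) (s≤s (symAt-inside x c ne))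
    astep⁺ (seekʳ {c} {gs = g ∷ gs} gt ne) le =
      astep (seek-right _ _ _ _ _ _ _ _ (suc g) gt ne) (move-right c) (s≤s (symAt-inside x c ne))
    astep⁺ (derive {c} {i} {t} {h} {s} {c₀} {c₁} {S} {g} {gs} {wt} {ps} arr r∈) le =
      subst (λ u → AStep _ (_ , c , u)) (symm (stack-++ ps gs))
        (astep (seek-act c i t h s c₀ c₁ S (suc g) arr
                 (∈-map⁺ (choose c i t h s c₀ c₁ S (symAt x c) g)
                   (subst (λ a → (wt , ps) ∈ rules i g a) (symm (arrived-reads arr)) r∈)))
               (move-stay c) le)
    astep⁺ (descend {c} {i} {t} {h} {s} {c₀} {c₁} {S} arr) le =
      astep (seek-act c i t (suc h) s c₀ c₁ S 0 arr (here refl)) (move-stay c) le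
    astep⁺ (settle {c} {i} {t} {s} {c₀} {c₁} {S} {st} arr s≡S f) le =
      subst (AStep _) (symm (embed-finish f))
        (astep (seek-act c i t 0 s c₀ c₁ S 0 arr (concluded (s ≟ S))) (move-stay c) le)
      where
        concluded : (d : Dec (s ≡ S)) → (st , 0 ∷ [] , stay) ∈ conclude c i t 0 s c₀ c₁ S (symAt x c) d
        concluded (no ¬p) = ⊥-elim (¬p s≡S)
        concluded (yes _) = ∈-map⁺ _ (finish⁺ _ _ _ _ _ _ _
          (subst (λ a → Finish c i t S _ _ (applies t a) st) (symm (arrived-reads arr)) f))

-- Invariants of the search

module Analysis {k : ℕ} (Y : System k) (w : ℕ → ℕ → ℕ) (M B : ℕ) (x : List (Fin k)) where
  open System Y
  open Costs Y x
  open Program Y w M B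
  open Semantics x

  total-++ : ∀ v ps gs → total v (ps ++ gs) ≡ total v ps + total v gs
  total-++ v ps gs = trans (cong sum (map-++ (cost v) ps gs)) (sum-++ (map (cost v) ps) (map (cost v) gs))

  module _ (i g : ℕ) where
    alternatives : Bool → List (ℕ × List ℕ)
    alternatives r = (dweight g , dprem g) ∷ (if r then (w i g , aprem g) ∷ [] else [])

    lower-by : ∀ r {wt ps} → (wt , ps) ∈ alternatives r →
               pick r (dcost (w i) g) (acost (w i) g) ≤ wt + total (w i) ps
    lower-by r     (here refl)         = pick≤ r _ _
    lower-by true  (there (here refl)) = m⊓n≤n _ _

    rule-lower : ∀ {wt ps} → (wt , ps) ∈ rules i g (symAt x (pos g)) → cost (w i) g ≤ wt + total (w i) ps
    rule-lower m = ≤-trans (≤-reflexive (cost-≡ (w i) g)) (lower-by (ready g) m)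

    optimal-by : ∀ r → ∃₂ λ wt ps → (wt , ps) ∈ alternatives r ×
                 pick r (dcost (w i) g) (acost (w i) g) ≡ wt + total (w i) ps
    optimal-by false = _ , _ , here refl , refl
    optimal-by true with ⊓-sel (dcost (w i) g) (acost (w i) g)
    ... | inj₁ e = _ , _ , here refl , e
    ... | inj₂ e = _ , _ , there (here refl) , e

    rule-optimal : ∃₂ λ wt ps → (wt , ps) ∈ rules i g (symAt x (pos g)) × cost (w i) g ≡ wt + total (w i) ps
    rule-optimal with wt , ps , m , e ← optimal-by (ready g) = wt , ps , m , trans (cost-≡ (w i) g) e

    unique-by : ∀ r {wt ps wt′ ps′} → ¬ (r ≡ true × dcost (w i) g ≡ acost (w i) g) →
      (wt , ps) ∈ alternatives r → (wt′ , ps′) ∈ alternatives r →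
      wt + total (w i) ps ≡ wt′ + total (w i) ps′ → (wt , ps) ≡ (wt′ , ps′)
    unique-by r nt (here refl) (here refl) e = refl
    unique-by true nt (here refl) (there (here refl)) e = ⊥-elim (nt (refl , e))
    unique-by true nt (there (here refl)) (here refl) e = ⊥-elim (nt (refl , symm e))
    unique-by true nt (there (here refl)) (there (here refl)) e = refl

    rule-unique : ∀ {wt ps wt′ ps′} → ¬ Tied (w i) g →
      (wt , ps) ∈ rules i g (symAt x (pos g)) → (wt′ , ps′) ∈ rules i g (symAt x (pos g)) →
      wt + total (w i) ps ≡ wt′ + total (w i) ps′ → (wt , ps) ≡ (wt′ , ps′)
    rule-unique = unique-by (ready g)

    premises< : ∀ r {wt ps} → (wt , ps) ∈ alternatives r → All (_< g) ps
    premises< r    (here refl)         = dprem< g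
    premises< true (there (here refl)) = aprem< g

  -- The least value that `spent` can have at the end of the current round.
  potential : Search → ℕ
  potential (search c i t h s c₀ c₁ S gs) = s + total (w i) gs + Σ< h (cost (w i))

  Within : SConfig → Set
  Within (running r)  = potential r ≤ Search.budget r
  Within (accepted _) = ⊤

  arith-derive : ∀ s wt a b r → (s + wt) + (a + b) + r ≡ s + ((wt + a) + b) + r
  arith-derive = solve-∀

  arith-descend : ∀ s c r → s + (c + 0) + r ≡ s + 0 + (c + r)
  arith-descend = solve-∀

  derive-potential : ∀ v s wt ps gs r →
    (s + wt) + total v (ps ++ gs) + r ≡ s + ((wt + total v ps) + total v gs) + r
  derive-potential v s wt ps gs r rewrite total-++ v ps gs = arith-derive s wt _ _ r

  -- During a round no step lowers the potential, and settling demands `s ≡ S`. A guess that exceeds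
  -- the budget can therefore never be repaired, and every configuration on an accepting path is
  -- within budget.
  within-back : ∀ {σ σ′} → SStep σ σ′ → Within σ′ → Within σ
  within-back (seekˡ _)   wi = wi
  within-back (seekʳ _ _) wi = wi
  within-back (derive {i = i} {h = h} {s = s} {g = g} {gs} {wt} {ps} _ r∈) wi =
    ≤-trans (+-monoˡ-≤ _ (+-monoʳ-≤ s (+-monoˡ-≤ _ (rule-lower i g r∈))))
      (≤-trans (≤-reflexive (symm (derive-potential (w i) s wt ps gs _))) wi)
  within-back (descend {i = i} {h = h} {s = s} _) wi =
    ≤-trans (≤-reflexive (symm (arith-descend s (cost (w i) h) _))) wi
  within-back (settle {s = s} _ refl _) wi = ≤-reflexive (trans (+-identityʳ _) (+-identityʳ s))

  -- Invariant of a cost accumulator `c`: what has been paid in, plus what optimal derivations of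
  -- the remaining items will pay in, is the total over the premises `ps`.
  Tracks : (ℕ → ℕ) → ℕ → ℕ → List ℕ → List ℕ → Set
  Tracks v h c gs ps =
    c + multiplicity h ps * total v gs + Σ< h (λ j → multiplicity j ps * cost v j) ≡ total v ps

  tracks-start : ∀ v {t} ps → All (_< t) ps → Tracks v t 0 [] ps
  tracks-start v {t} ps as rewrite *-zeroʳ (multiplicity t ps) = sums ps as
    where
      sums : ∀ ps → All (_< t) ps → Σ< t (λ j → multiplicity j ps * cost v j) ≡ total v ps
      sums [] [] = Σ<-zero t
      sums (p ∷ ps) (a ∷ as) = trans (Σ<-cong t (λ j _ → split j))
        (trans (Σ<-+ t _ _) (cong₂ _+_ (Σ<-indicator t (cost v) a) (sums ps as)))
        where
          split : ∀ j → multiplicity j (p ∷ ps) * cost v j ≡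
                        (if does (p ≟ j) then cost v j else 0) + multiplicity j ps * cost v j
          split j rewrite count-∷ (_≟ j) p ps with p ≡ᵇ j
          ... | true  = refl
          ... | false = refl

  tracks-derive : ∀ v {h c g gs wt qs} ps → cost v g ≡ wt + total v ps →
    Tracks v h c (g ∷ gs) qs → Tracks v h (c + multiplicity h qs * wt) (ps ++ gs) qs
  tracks-derive v {h} {c} {g} {gs} {wt} {qs} ps e tr
    rewrite total-++ v ps gs =
    trans (lem c (multiplicity h qs) wt (total v ps) (total v gs) _)
      (trans (cong (λ u → c + multiplicity h qs * (u + total v gs) + _) (symm e)) tr)
    where
      lem : ∀ c m wt a b r → (c + m * wt) + m * (a + b) + r ≡ c + m * ((wt + a) + b) + r
      lem = solve-∀

  tracks-descend : ∀ v {h c qs} → Tracks v (suc h) c [] qs → Tracks v h c (h ∷ []) qs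
  tracks-descend v {h} {c} {qs} tr =
    trans (lem c (multiplicity h qs) (multiplicity (suc h) qs) (cost v h) _) tr
    where
      lem : ∀ c m m′ a r → c + m * (a + 0) + r ≡ c + m′ * 0 + (m * a + r)
      lem = solve-∀

  tracks-end : ∀ v {c qs} → Tracks v 0 c [] qs → c ≡ total v qs
  tracks-end v {c} {qs} tr = trans (lem c (multiplicity 0 qs)) tr
    where
      lem : ∀ c m → c ≡ c + m * 0 + 0
      lem = solve-∀

  -- `budget≡` is the hypothesis of inductive counting. `spent≡` is an equality, unlike `Within`: no
  -- weight has been wasted so far, so the first bad guess breaks the budget at once.
  record Exact (r : Search) : Set where
    open Search r
    field
      agenda<  : All (_< target) agenda
      target≤  : target ≤ M
      current≤ : current ≤ target
      untied   : ¬ TiedBelow (w family) target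
      budget≡  : budget ≡ Σ< target (cost (w family))
      spent≡   : potential r ≡ budget
      tracks₀  : Tracks (w family) current cost₀ agenda (dprem target)
      tracks₁  : Tracks (w family) current cost₁ agenda (aprem target)

  Good : SConfig → Set
  Good (running r)  = Exact r
  Good (accepted _) = ∃ λ i → cost (w i) M < B

  start : ℕ → ℕ → ℕ → ℕ → Search
  start c i t S = search c i t t 0 0 0 S []

  start-exact : ∀ c i t S → t ≤ M → ¬ TiedBelow (w i) t → S ≡ Σ< t (cost (w i)) → Exact (start c i t S)
  start-exact c i t S t≤ nt S≡ = record
    { agenda< = [] ; target≤ = t≤ ; current≤ = ≤-refl ; untied = nt ; budget≡ = S≡
    ; spent≡ = symm S≡ ; tracks₀ = tracks-start (w i) (dprem t) (dprem< t)
    ; tracks₁ = tracks-start (w i) (aprem t) (aprem< t) }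

  untied-suc : ∀ {v t} → ¬ TiedBelow v t → ¬ Tied v t → ¬ TiedBelow v (suc t)
  untied-suc {t = t} nb nt (u , s≤s u≤t , ti) with u ≟ t
  ... | yes refl = nt ti
  ... | no u≢t   = nb (u , ≤∧≢⇒< u≤t u≢t , ti)

  -- Squeezed between `rule-lower` and the budget: before the step the potential is already `S`, so
  -- the guessed rule has no slack.
  derive-optimal : ∀ {c i t h s c₀ c₁ S g gs wt ps} →
    Exact (search c i t h s c₀ c₁ S (g ∷ gs)) → (wt , ps) ∈ rules i g (symAt x (pos g)) →
    (s + wt) + total (w i) (ps ++ gs) + Σ< h (cost (w i)) ≤ S → cost (w i) g ≡ wt + total (w i) ps
  derive-optimal {i = i} {h = h} {s = s} {g = g} {gs} {wt} {ps} ex r∈ wi =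
    ≤-antisym (rule-lower i g r∈) (+-cancelʳ-≤ (total (w i) gs) _ _ (+-cancelˡ-≤ s _ _
      (+-cancelʳ-≤ (Σ< h (cost (w i))) _ _
        (≤-trans (≤-reflexive (symm (derive-potential (w i) s wt ps gs _)))
          (≤-trans wi (≤-reflexive (symm (Exact.spent≡ ex))))))))

  settle-cost : ∀ {c i t s c₀ c₁ S} → Exact (search c i t 0 s c₀ c₁ S []) →
    dweight t + c₀ ≡ dcost (w i) t × w i t + c₁ ≡ acost (w i) t
  settle-cost {i = i} {t} ex = cong (dweight t +_) (tracks-end (w i) {qs = dprem t} (Exact.tracks₀ ex)) ,
                               cong (w i t +_) (tracks-end (w i) {qs = aprem t} (Exact.tracks₁ ex))

  good-step : ∀ {r σ′} → SStep (running r) σ′ → Exact r → Within σ′ → Good σ′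
  good-step (seekˡ _) ex wi = record { Exact ex }
  good-step (seekʳ _ _) ex wi = record { Exact ex }
  good-step {search c i t h s c₀ c₁ S (g ∷ gs)} (derive {wt = wt} {ps = ps} _ r∈) ex wi = record
    { agenda< = AllP.++⁺ (All.map (λ p<g → <-trans p<g g<t) (premises< i g _ r∈)) gs<t
    ; target≤ = target≤ ; current≤ = current≤ ; untied = untied ; budget≡ = budget≡
    ; spent≡ = trans (derive-potential (w i) s wt ps gs _)
        (trans (cong (λ u → s + (u + total (w i) gs) + Σ< h (cost (w i))) (symm opt)) spent≡)
    ; tracks₀ = tracks-derive (w i) {h} {c₀} {g} {gs} {wt} {dprem t} ps opt tracks₀
    ; tracks₁ = tracks-derive (w i) {h} {c₁} {g} {gs} {wt} {aprem t} ps opt tracks₁ }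
    where
      open Exact ex
      g<t  = All.head agenda<
      gs<t = All.tail agenda<
      opt  = derive-optimal ex r∈ wi
  good-step {search c i t (suc h) s c₀ c₁ S []} (descend _) ex wi = record
    { agenda< = current≤ ∷ []
    ; target≤ = target≤ ; current≤ = <⇒≤ current≤ ; untied = untied ; budget≡ = budget≡
    ; spent≡ = trans (arith-descend s (cost (w i) h) _) spent≡
    ; tracks₀ = tracks-descend (w i) {h} {c₀} {dprem t} tracks₀
    ; tracks₁ = tracks-descend (w i) {h} {c₁} {aprem t} tracks₁ }
    where open Exact ex
  good-step {search c i t 0 s c₀ c₁ S []} (settle _ _ (restart _ _)) ex wi =
    -- The next family starts at item 0 with sum 0, where nothing has to be known about its weights.
    start-exact c (suc i) 0 0 z≤n (λ ()) refl
  good-step {search c i t 0 s c₀ c₁ S []} (settle _ _ (advance nt t≢M)) ex wi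
    with e₀ , e₁ ← settle-cost ex rewrite e₀ | e₁ =
    start-exact c i (suc t) _ (≤∧≢⇒< target≤ t≢M) (untied-suc untied nt)
      (trans (+-comm S _) (cong₂ _+_ (symm (cost-≡ (w i) t)) budget≡))
    where open Exact ex
  good-step {search c i t 0 s c₀ c₁ S []} (settle _ _ (accept nt refl b<B)) ex wi
    with e₀ , e₁ ← settle-cost ex rewrite e₀ | e₁ =
    i , ≤-<-trans (≤-reflexive (cost-≡ (w i) t)) b<B

  finish-unique : ∀ {c i t S b₀ b₁ r st st′} → Finish c i t S b₀ b₁ r st → Finish c i t S b₀ b₁ r st′ → st ≡ st′
  finish-unique (restart _ _) (restart _ _) = refl
  finish-unique (restart p q) (advance n _) = ⊥-elim (n (p , q))
  finish-unique (restart p q) (accept n _ _) = ⊥-elim (n (p , q))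
  finish-unique (advance n _) (restart p q) = ⊥-elim (n (p , q))
  finish-unique (advance _ _) (advance _ _) = refl
  finish-unique (advance _ n) (accept _ e _) = ⊥-elim (n e)
  finish-unique (accept n _ _) (restart p q) = ⊥-elim (n (p , q))
  finish-unique (accept _ e _) (advance _ n) = ⊥-elim (n e)
  finish-unique (accept _ _ _) (accept _ _ _) = refl

  -- Both guesses are optimal and hence equally costly. Different rules of equal cost would be a tie
  -- at `g`, which lies below the target, where earlier rounds have excluded ties.
  derive-det : ∀ {c i t h s c₀ c₁ S g gs wt ps wt′ ps′} → Exact (search c i t h s c₀ c₁ S (g ∷ gs)) →
    (wt , ps) ∈ rules i g (symAt x (pos g)) → (wt′ , ps′) ∈ rules i g (symAt x (pos g)) →
    (s + wt) + total (w i) (ps ++ gs) + Σ< h (cost (w i)) ≤ S →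
    (s + wt′) + total (w i) (ps′ ++ gs) + Σ< h (cost (w i)) ≤ S → (wt , ps) ≡ (wt′ , ps′)
  derive-det {i = i} {g = g} ex r∈ r∈′ wi wi′ =
    rule-unique i g (λ ti → untied (g , All.head agenda< , ti)) r∈ r∈′
      (trans (symm (derive-optimal ex r∈ wi)) (derive-optimal ex r∈′ wi′))
    where open Exact ex

  not-both : ∀ {c p} → Arrived c p → ¬ (c < p × symAt x c ≢ dollar)
  not-both (_ , d) (gt , ne) = ne (d gt)

  deterministic : ∀ {r σ σ′} → Exact r → SStep (running r) σ → Within σ → SStep (running r) σ′ → Within σ′ → σ ≡ σ′
  deterministic ex (seekˡ _) wi (seekˡ _) wi′ = refl
  deterministic ex (seekˡ lt) wi (seekʳ gt _) wi′ = ⊥-elim (<-asym lt gt)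
  deterministic ex (seekˡ lt) wi (derive (n , _) _) wi′ = ⊥-elim (n lt)
  deterministic ex (seekˡ lt) wi (descend (n , _)) wi′ = ⊥-elim (n lt)
  deterministic ex (seekˡ lt) wi (settle (n , _) _ _) wi′ = ⊥-elim (n lt)
  deterministic ex (seekʳ gt _) wi (seekˡ lt) wi′ = ⊥-elim (<-asym lt gt)
  deterministic ex (seekʳ _ _) wi (seekʳ _ _) wi′ = refl
  deterministic ex (seekʳ gt ne) wi (derive arr _) wi′ = ⊥-elim (not-both arr (gt , ne))
  deterministic ex (seekʳ gt ne) wi (descend arr) wi′ = ⊥-elim (not-both arr (gt , ne))
  deterministic ex (seekʳ gt ne) wi (settle arr _ _) wi′ = ⊥-elim (not-both arr (gt , ne))
  deterministic ex (derive (n , _) _) wi (seekˡ lt) wi′ = ⊥-elim (n lt)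
  deterministic ex (derive arr _) wi (seekʳ gt ne) wi′ = ⊥-elim (not-both arr (gt , ne))
  deterministic ex (derive _ r∈) wi (derive _ r∈′) wi′ with refl ← derive-det ex r∈ r∈′ wi wi′ = refl
  deterministic ex (descend (n , _)) wi (seekˡ lt) wi′ = ⊥-elim (n lt)
  deterministic ex (descend arr) wi (seekʳ gt ne) wi′ = ⊥-elim (not-both arr (gt , ne))
  deterministic ex (descend _) wi (descend _) wi′ = refl
  deterministic ex (settle (n , _) _ _) wi (seekˡ lt) wi′ = ⊥-elim (n lt)
  deterministic ex (settle arr _ _) wi (seekʳ gt ne) wi′ = ⊥-elim (not-both arr (gt , ne))
  deterministic ex (settle _ _ f) wi (settle _ _ f′) wi′ = cong (resume _) (finish-unique f f′)

-- Completeness: with small costs and one tie-free family the search never gets stuck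

module Progress {k : ℕ} (Y : System k) (w : ℕ → ℕ → ℕ) (M B : ℕ) (x : List (Fin k))
                (i⋆ : ℕ) (untied⋆ : ¬ Costs.TiedBelow Y x (w i⋆) (suc M))
                (cost<B : ∀ i → Costs.cost Y x (w i) M < B) where
  open System Y
  open Costs Y x
  open Program Y w M B
  open Semantics x
  open Analysis Y w M B x

  -- Keeps the family register small: a tie under family `i` shows `i ≢ i⋆`, so a restart never
  -- passes `i⋆`. An earlier family may also get to the last item untied, which is why `cost<B`
  -- speaks of all families.
  FamilyOK : SConfig → Set
  FamilyOK (running r)  = Search.family r ≤ i⋆
  FamilyOK (accepted _) = ⊤

  Next : Search → Set
  Next r = ∃ λ σ → SStep (running r) σ × Within σ × FamilyOK σ

  finishing : ∀ {c i t s c₀ c₁ S} → Exact (search c i t 0 s c₀ c₁ S []) → i ≤ i⋆ →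
    Dec (Tied (w i) t) → Dec (t ≡ M) → ∃ λ st → Within (resume c st) × FamilyOK (resume c st) ×
    Finish c i t S (dweight t + c₀) (w i t + c₁) (ready t) st
  finishing {c} {i} {t} {S = S} ex i≤ tied? last? with e₀ , e₁ ← settle-cost ex rewrite e₀ | e₁ =
    by tied? last?
    where
      open Exact ex
      by : Dec (Tied (w i) t) → Dec (t ≡ M) → ∃ λ st → Within (resume c st) × FamilyOK (resume c st) ×
           Finish c i t S (dcost (w i) t) (acost (w i) t) (ready t) st
      by (yes ti) _ = _ , z≤n , ≤∧≢⇒< i≤ i≢ , restart (proj₁ ti) (proj₂ ti)
        where
          i≢ : i ≢ i⋆
          i≢ refl = untied⋆ (t , s≤s target≤ , ti)
      by (no nt) (no t≢M) = _ ,
        ≤-reflexive (trans (cong₂ _+_ (cost-≡ (w i) t) (symm budget≡)) (+-comm _ S)) ,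
        i≤ , advance nt t≢M
      by (no nt) (yes refl) = nothing , tt , tt ,
        accept nt refl (≤-<-trans (≤-reflexive (symm (cost-≡ (w i) t))) (cost<B i))

  arrived-next : ∀ r → Exact r → Search.family r ≤ i⋆ →
                 Arrived (Search.head r) (goal (Search.target r) (Search.agenda r)) → Next r
  arrived-next (search c i t h s c₀ c₁ S (g ∷ gs)) ex i≤ arr
    with wt , ps , r∈ , e ← rule-optimal i g =
    _ , derive arr r∈ , ≤-reflexive (trans (derive-potential (w i) s wt ps gs _)
          (trans (cong (λ u → s + (u + total (w i) gs) + Σ< h (cost (w i))) (symm e)) (Exact.spent≡ ex))) , i≤
  arrived-next (search c i t (suc h) s c₀ c₁ S []) ex i≤ arr =
    _ , descend arr , ≤-reflexive (trans (arith-descend s (cost (w i) h) _) (Exact.spent≡ ex)) , i≤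
  arrived-next (search c i t zero s c₀ c₁ S []) ex i≤ arr
    with st , wi , fam , f ← finishing ex i≤ (Tied? (w i) t) (t ≟ M) =
    _ , settle arr (trans (symm (trans (+-identityʳ _) (+-identityʳ s))) (Exact.spent≡ ex)) f , wi , fam

  progress : ∀ r → Exact r → Search.family r ≤ i⋆ → Next r
  progress r@(search c i t h s c₀ c₁ S gs) ex i≤
    with goal t gs <? c | c <? goal t gs | dollar? (symAt x c)
  progress (search (suc c) i t h s c₀ c₁ S gs) ex i≤ | yes lt | _ | _ =
    _ , seekˡ lt , ≤-reflexive (Exact.spent≡ ex) , i≤
  ... | no _ | yes gt | no ne = _ , seekʳ gt ne , ≤-reflexive (Exact.spent≡ ex) , i≤
  ... | no ¬lt | no ¬gt | _ = arrived-next r ex i≤ (¬lt , ⊥-elim ∘ ¬gt)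
  ... | no ¬lt | yes _ | yes d = arrived-next r ex i≤ (¬lt , λ _ → d)

-- Numerals in base `K + 1`, for the clock and for the states

module Radix (K : ℕ) where

  radix : ∀ {n} → ℕ → Vec ℕ n → ℕ
  radix a []       = a
  radix a (d ∷ ds) = radix (a * suc K + d) ds

  radix-< : ∀ {n a a′} {ds ds′ : Vec ℕ n} → a < a′ → AllV (_≤ K) ds → radix a ds < radix a′ ds′
  radix-< {ds′ = []} a<a′ [] = a<a′
  radix-< {a = a} {a′} {d ∷ ds} {d′ ∷ ds′} a<a′ (d≤K ∷ ds≤K) = radix-< {ds′ = ds′} (begin-strict
    a * suc K + d        <⟨ +-monoʳ-< (a * suc K) (s≤s d≤K) ⟩
    a * suc K + suc K    ≡⟨ +-comm (a * suc K) (suc K) ⟩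
    suc a * suc K        ≤⟨ *-monoˡ-≤ (suc K) a<a′ ⟩
    a′ * suc K           ≤⟨ m≤m+n _ d′ ⟩
    a′ * suc K + d′      ∎) ds≤K
    where open ≤-Reasoning

  -- Only the trailing digits of the smaller numeral need a bound, so a step can be measured before
  -- its result is known to fit the registers.
  radix-lex : ∀ {m n} a (pre : Vec ℕ m) {d d′} {ds ds′ : Vec ℕ n} → d < d′ → AllV (_≤ K) ds →
              radix a (pre ++ᵥ d ∷ ds) < radix a (pre ++ᵥ d′ ∷ ds′)
  radix-lex a []        {ds′ = ds′} d<d′ ds≤K = radix-< {ds′ = ds′} (+-monoʳ-< (a * suc K) d<d′) ds≤K
  radix-lex a (p ∷ pre) {ds′ = ds′} d<d′ ds≤K = radix-lex (a * suc K + p) pre {ds′ = ds′} d<d′ ds≤K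

  radix-bound : ∀ {n} a {ds : Vec ℕ n} → AllV (_≤ K) ds → radix a ds < suc a * suc K ^ n
  radix-bound a [] = ≤-reflexive (symm (*-identityʳ (suc a)))
  radix-bound {suc n} a {d ∷ ds} (d≤K ∷ ds≤K) = begin-strict
    radix (a * suc K + d) ds        <⟨ radix-bound (a * suc K + d) ds≤K ⟩
    suc (a * suc K + d) * suc K ^ n ≤⟨ *-monoˡ-≤ (suc K ^ n) (s≤s (+-monoʳ-≤ (a * suc K) d≤K)) ⟩
    suc (a * suc K + K) * suc K ^ n ≡⟨ lem a K (suc K ^ n) ⟩
    suc a * (suc K * suc K ^ n)     ∎
    where
      open ≤-Reasoning
      lem : ∀ a K p → suc (a * suc K + K) * p ≡ suc a * (suc K * p)
      lem = solve-∀

  digits : ∀ {n} → Fin (suc K ^ n) → Vec ℕ n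
  digits {zero}  q = []
  digits {suc n} q = toℕ (proj₁ (remQuot {suc K} (suc K ^ n) q)) ∷ digits {n} (proj₂ (remQuot {suc K} (suc K ^ n) q))

  digits≤ : ∀ {n} (q : Fin (suc K ^ n)) → AllV (_≤ K) (digits {n} q)
  digits≤ {zero}  q = []
  digits≤ {suc n} q = toℕ≤pred[n] (proj₁ (remQuot {suc K} (suc K ^ n) q)) ∷ digits≤ {n} (proj₂ (remQuot {suc K} (suc K ^ n) q))

  digits-injective : ∀ {n} (q q′ : Fin (suc K ^ n)) → digits {n} q ≡ digits {n} q′ → q ≡ q′
  digits-injective {zero} zero zero e = refl
  digits-injective {suc n} q q′ e =
    trans (symm (combine-remQuot {suc K} (suc K ^ n) q))
      (trans (cong₂ combine (toℕ-injective (VecP.∷-injectiveˡ e)) (digits-injective {n} _ _ (VecP.∷-injectiveʳ e)))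
        (combine-remQuot {suc K} (suc K ^ n) q′))

  digits-surjective : ∀ {n} {v : Vec ℕ n} → AllV (_≤ K) v → ∃ λ q → digits {n} q ≡ v
  digits-surjective [] = zero , refl
  digits-surjective {suc n} (_∷_ {x = d} d≤K ds≤K) with q , e ← digits-surjective ds≤K =
    combine d′ q , cong₂ _∷_
      (trans (cong (toℕ ∘ proj₁) (remQuot-combine {suc K} d′ q)) (toℕ-fromℕ< (s≤s d≤K)))
      (trans (cong (digits {n} ∘ proj₂) (remQuot-combine {suc K} d′ q)) e)
    where d′ = fromℕ< (s≤s d≤K)

-- Termination

module Clock {k : ℕ} (Y : System k) (w : ℕ → ℕ → ℕ) (M B K : ℕ)
             (w>0 : ∀ i t → 1 ≤ w i t) (pos≤K : ∀ t → System.pos Y t ≤ K) (x : List (Fin k)) where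
  open System Y
  open Program Y w M B
  open Semantics x
  open Radix K

  gap : ℕ → ℕ → ℕ
  gap c p = K ∸ ∣ c - p ∣

  -- A lexicographic clock: restarting raises the family, advancing raises the target, descending
  -- lowers `current`, deriving raises `spent` because weights are positive, and seeking closes the
  -- gap to the address. Acceptance gets the first value beyond all five-digit numerals.
  measure : SConfig → ℕ
  measure (running (search c i t h s _ _ _ gs)) = radix 0 (i ∷ t ∷ K ∸ h ∷ s ∷ gap c (goal t gs) ∷ [])
  measure (accepted _) = suc K ^ 5

  digitsOf : Search → Vec ℕ 8
  digitsOf (search c i t h s c₀ c₁ S gs) = c ∷ i ∷ t ∷ h ∷ s ∷ c₀ ∷ c₁ ∷ S ∷ []

  DigitsOK : SConfig → Set
  DigitsOK (running r)  = AllV (_≤ K) (digitsOf r)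
  DigitsOK (accepted _) = ⊤

  goal≤K : ∀ t gs → goal t gs ≤ K
  goal≤K t []       = pos≤K t
  goal≤K t (g ∷ gs) = pos≤K g

  closer : ∀ {d d′} → d ≡ suc d′ → d ≤ K → K ∸ d < K ∸ d′
  closer refl d≤K = ∸-monoʳ-< ≤-refl d≤K

  distance-left : ∀ c p → p ≤ c → ∣ suc c - p ∣ ≡ suc ∣ c - p ∣
  distance-left c p p≤c = trans (m≤n⇒∣n-m∣≡n∸m (m≤n⇒m≤1+n p≤c))
    (trans (+-∸-assoc 1 p≤c) (cong suc (symm (m≤n⇒∣n-m∣≡n∸m p≤c))))

  distance-right : ∀ c p → c < p → ∣ c - p ∣ ≡ suc ∣ suc c - p ∣
  distance-right c (suc p) (s≤s c≤p) =
    trans (∣-∣-comm c (suc p)) (trans (distance-left p c c≤p) (cong suc (∣-∣-comm p c)))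

  weight>0 : ∀ i g r {wt ps} → (wt , ps) ∈ (dweight g , dprem g) ∷ (if r then (w i g , aprem g) ∷ [] else []) → 1 ≤ wt
  weight>0 i g r    (here refl)         = dweight>0 g
  weight>0 i g true (there (here refl)) = w>0 i g

  gap≤K : ∀ c p → gap c p ≤ K
  gap≤K c p = m∸n≤m K ∣ c - p ∣

  measure-bound : ∀ σ → DigitsOK σ → measure σ ≤ suc K ^ 5
  measure-bound (running (search c i t h s _ _ _ gs)) (_ ∷ i≤ ∷ t≤ ∷ _ ∷ s≤ ∷ _) =
    ≤-trans (<⇒≤ (radix-bound 0 (i≤ ∷ t≤ ∷ m∸n≤m K h ∷ s≤ ∷ gap≤K c (goal t gs) ∷ []))) (≤-reflexive (+-identityʳ _))
  measure-bound (accepted _) _ = ≤-refl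

  measure-< : ∀ {σ σ′} → SStep σ σ′ → DigitsOK σ → measure σ < measure σ′
  measure-< (seekˡ {c} {t = t} {gs = gs} (s≤s p≤c)) (c≤ ∷ _) = +-monoʳ-< _
    (closer (distance-left c (goal t gs) p≤c)
      (≤-trans (≤-reflexive (m≤n⇒∣n-m∣≡n∸m (m≤n⇒m≤1+n p≤c))) (≤-trans (m∸n≤m _ (goal t gs)) c≤)))
  measure-< (seekʳ {c} {t = t} {gs = gs} gt ne) _ = +-monoʳ-< _
    (closer (distance-right c (goal t gs) gt)
      (≤-trans (≤-reflexive (m≤n⇒∣m-n∣≡n∸m (<⇒≤ gt))) (≤-trans (m∸n≤m _ c) (goal≤K t gs))))
  measure-< (derive {c} {i} {t} {h} {s} {g = g} {gs} {wt} {ps} _ r∈) _ =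
    radix-lex 0 (i ∷ t ∷ K ∸ h ∷ []) {ds = gap c (pos g) ∷ []} {gap c (goal t (ps ++ gs)) ∷ []}
      (m<m+n s (weight>0 i g _ r∈)) (gap≤K c (pos g) ∷ [])
  measure-< (descend {c} {i} {t} {h} {s} _) (_ ∷ _ ∷ _ ∷ h≤ ∷ s≤ ∷ _) =
    radix-lex 0 (i ∷ t ∷ []) {ds = s ∷ gap c (pos t) ∷ []} {s ∷ gap c (pos h) ∷ []}
      (∸-monoʳ-< ≤-refl h≤) (s≤ ∷ gap≤K c (pos t) ∷ [])
  measure-< (settle {c} {i} {t} {s} _ _ (restart _ _)) (_ ∷ _ ∷ t≤ ∷ _ ∷ s≤ ∷ _) =
    radix-lex 0 [] {i} {suc i} {t ∷ K ∷ s ∷ gap c (pos t) ∷ []} {0 ∷ K ∷ 0 ∷ gap c (pos 0) ∷ []}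
      ≤-refl (t≤ ∷ ≤-refl ∷ s≤ ∷ gap≤K c (pos t) ∷ [])
  measure-< (settle {c} {i} {t} {s} _ _ (advance _ _)) (_ ∷ _ ∷ _ ∷ _ ∷ s≤ ∷ _) =
    radix-lex 0 (i ∷ []) {t} {suc t} {K ∷ s ∷ gap c (pos t) ∷ []} {K ∸ suc t ∷ 0 ∷ gap c (pos (suc t)) ∷ []}
      ≤-refl (≤-refl ∷ s≤ ∷ gap≤K c (pos t) ∷ [])
  measure-< (settle {c} {i} {t} {s} _ _ (accept _ _ _)) (_ ∷ i≤ ∷ t≤ ∷ _ ∷ s≤ ∷ _) =
    <-≤-trans (radix-bound 0 (i≤ ∷ t≤ ∷ ≤-refl ∷ s≤ ∷ gap≤K c (pos t) ∷ [])) (≤-reflexive (+-identityʳ _))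

-- The search as a pushdown automaton

module Paths {k : ℕ} (P : 2NPDA k) (x : List (Fin k)) where
  open 2NPDA P

  data AccFrom : Config P → List (Config P) → Set where
    stop : ∀ {c} → acc (proj₁ c) ≡ true → AccFrom c (c ∷ [])
    go   : ∀ {c c′ cs} → Step P x c c′ → AccFrom c′ cs → AccFrom c (c ∷ cs)

  halted : ∀ {c c′} → acc (proj₁ c) ≡ true → ¬ Step P x c c′
  halted a (step δ≡ _ _) with () ← trans (symm δ≡) (halting-no-move _ _ _ _ _ _ (inj₁ a))

  fromChain : ∀ {c cs d} → Chain P x (c ∷ cs) → last (c ∷ cs) ≡ just d → acc (proj₁ d) ≡ true → AccFrom c (c ∷ cs)
  fromChain (single c) refl a = stop a
  fromChain (cons st ch) l a = go st (fromChain ch l a)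

  toChain : ∀ {c cs} → AccFrom c cs → ∃ λ rest → cs ≡ c ∷ rest × Chain P x cs ×
            Σ (Config P) λ d → last cs ≡ just d × acc (proj₁ d) ≡ true
  toChain (stop a) = [] , refl , single _ , _ , refl , a
  toChain (go st ac) with _ , refl , ch , d , l , a ← toChain ac = _ , refl , cons st ch , d , l , a

  fromAccPath : ∀ {cs} → AccPath P x cs → AccFrom (initConfig P) cs
  fromAccPath ((_ , _ , refl , refl , ch) , d , l , a) = fromChain ch l a

  toAccPath : ∀ {cs} → AccFrom (initConfig P) cs → AccPath P x cs
  toAccPath ac with rest , refl , ch , last ← toChain ac = (_ , rest , refl , refl , ch) , last

_≟ᵈ_ : DecidableEquality Dir
left  ≟ᵈ left  = yes refl
left  ≟ᵈ stay  = no λ ()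
left  ≟ᵈ right = no λ ()
stay  ≟ᵈ left  = no λ ()
stay  ≟ᵈ stay  = yes refl
stay  ≟ᵈ right = no λ ()
right ≟ᵈ left  = no λ ()
right ≟ᵈ stay  = no λ ()
right ≟ᵈ right = yes refl

_≟ᵃ_ : DecidableEquality Action
_≟ᵃ_ = ProductP.≡-dec (MaybeP.≡-dec (VecP.≡-dec _≟_)) (ProductP.≡-dec (ListP.≡-dec _≟_) _≟ᵈ_)

open DecMembership _≟ᵃ_ using (_∈?_)

does⁻ : ∀ {A : Set} (d : Dec A) → does d ≡ true → A
does⁻ (yes a) refl = a

-- Opaque: a definitional comparison of two instances would unfold the powers into unary numerals.
opaque
  searchSize : ℕ → ℕ → ℕ
  searchSize K M = suc (suc K ^ 8) * sumPow (suc M) 2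

  searchTime : ℕ → ℕ
  searchTime K = suc K ^ 5

module Compiled {k : ℕ} (Y : System k) (w : ℕ → ℕ → ℕ) (M B K : ℕ)
                (w>0 : ∀ i t → 1 ≤ w i t) (pos≤K : ∀ t → System.pos Y t ≤ K) where
  open System Y
  open Program Y w M B
  open Radix K

  decode : Fin (suc (suc K ^ 8)) → Maybe (Vec ℕ 8)
  decode zero    = nothing
  decode (suc q) = just (digits {8} q)

  decode-injective : ∀ p q → decode p ≡ decode q → p ≡ q
  decode-injective zero    zero    e = refl
  decode-injective (suc p) (suc q) e = cong suc (digits-injective {8} p q (MaybeP.just-injective e))

  zeros : ∃ λ q → digits {8} q ≡ 0 ∷ 0 ∷ 0 ∷ 0 ∷ 0 ∷ 0 ∷ 0 ∷ 0 ∷ []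
  zeros = digits-surjective (z≤n ∷ z≤n ∷ z≤n ∷ z≤n ∷ z≤n ∷ z≤n ∷ z≤n ∷ z≤n ∷ [])

  act-short : ∀ c i t h s c₀ c₁ S a z {st ws d} → (st , ws , d) ∈ act c i t h s c₀ c₁ S a z → length ws ≤ 2
  act-short c i t h s c₀ c₁ S a (suc g) m with (wt , ps) , r∈ , refl ← ∈-map⁻ _ m =
    ≤-trans (≤-reflexive (length-map suc ps)) (short (applies g a) r∈)
    where
      short : ∀ r → (wt , ps) ∈ (dweight g , dprem g) ∷ (if r then (w i g , aprem g) ∷ [] else []) → length ps ≤ 2
      short r    (here refl)         = dprem≤2 g
      short true (there (here refl)) = aprem≤2 g
  act-short c i t (suc h) s c₀ c₁ S a zero (here refl) = ≤-refl
  act-short c i t zero s c₀ c₁ S a zero m with s ≟ S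
  ... | yes _ with _ , _ , refl ← ∈-map⁻ _ m = s≤s z≤n

  actions-short : ∀ v a z {st ws d} → (st , ws , d) ∈ actions v a z → length ws ≤ 2
  actions-short (just (c ∷ i ∷ t ∷ h ∷ s ∷ c₀ ∷ c₁ ∷ S ∷ [])) a z m
    with address t z <? c | c <? address t z | dollar? a
  actions-short (just _) a z (here refl) | yes _ | _ | _ = s≤s z≤n
  actions-short (just _) a z (here refl) | no _ | yes _ | no _ = s≤s z≤n
  ... | no _ | yes _ | yes _ = act-short c i t h s c₀ c₁ S a z m
  ... | no _ | no _ | _ = act-short c i t h s c₀ c₁ S a z m

  accepting : Fin (suc (suc K ^ 8)) → Bool
  accepting zero    = true
  accepting (suc _) = false

  machine : 2NPDA k
  machine = record
    -- The agenda of an exact search stays below the target, so `suc g` is at most `M`. A move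
    -- pushes at most two symbols: two premises, or an item over the bottom marker.
    { nQ = suc (suc K ^ 8) ; nΓ = suc M ; e = 2
    ; q₀ = suc (proj₁ zeros) ; Z₀ = zero
    ; acc = accepting ; rej = λ _ → false
    -- A successor with a register above `K` or a stack entry above `M` has no code and is dropped.
    -- `realizable` shows that this does not happen on the intended path.
    ; δ = λ p a Z q ws d → does ((decode q , map toℕ ws , d) ∈? actions (decode p) a (toℕ Z))
    ; acc-rej-disjoint = λ _ _ ()
    ; halting-no-move = λ { zero _ _ _ _ _ _ → refl ; (suc _) _ _ _ _ _ (inj₁ ()) ; (suc _) _ _ _ _ _ (inj₂ ()) }
    ; push-bound = λ p a Z q ws d δ≡ → ≤-trans (≤-reflexive (symm (length-map toℕ ws)))
        (actions-short (decode p) a (toℕ Z)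
          (does⁻ ((decode q , map toℕ ws , d) ∈? actions (decode p) a (toℕ Z)) δ≡))
    }

  opaque
    unfolding searchSize

    machine-size : size machine ≡ searchSize K M
    machine-size = refl

  observe : Config machine → Config′
  observe (q , i , zs) = decode q , i , map toℕ zs

  observe-injective : ∀ c c′ → observe c ≡ observe c′ → c ≡ c′
  observe-injective (q , i , zs) (q′ , i′ , zs′) e =
    cong₂ _,_ (decode-injective q q′ (cong proj₁ e))
      (cong₂ _,_ (cong (proj₁ ∘ proj₂) e) (map-injective toℕ-injective (cong (proj₂ ∘ proj₂) e)))

  numerals : ∀ {ws : List ℕ} → All (_≤ M) ws → ∃ λ zs → map (toℕ {suc M}) zs ≡ ws
  numerals [] = [] , refl
  numerals (w≤ ∷ ws≤) with zs , e ← numerals ws≤ = fromℕ< (s≤s w≤) ∷ zs , cong₂ _∷_ (toℕ-fromℕ< (s≤s w≤)) e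

  module _ (x : List (Fin k)) where
    open Semantics x
    open Analysis Y w M B x
    open Clock Y w M B K w>0 pos≤K x
    open Paths machine x

    step⇒ : ∀ {c c′} → Step machine x c c′ → AStep (observe c) (observe c′)
    step⇒ (step {p} {i} {Z} {s} {q} {ws} {d} {j} δ≡ mv j≤) =
      subst (λ u → AStep _ (decode q , j , u)) (symm (map-++ toℕ ws s))
        (astep (does⁻ ((decode q , map toℕ ws , d) ∈? actions (decode p) (symAt x i) (toℕ Z)) δ≡) mv j≤)

    step⇐ : ∀ c {a st j zs} → observe c ≡ a → AStep a (st , j , zs) → (∃ λ q → decode q ≡ st) → All (_≤ M) zs →
            ∃ λ c′ → observe c′ ≡ (st , j , zs) × Step machine x c c′
    step⇐ (p , i , Z ∷ s) refl (astep {ws = ws} m mv j≤) (q , refl) zs≤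
      with ws′ , refl ← numerals (AllP.++⁻ˡ ws zs≤) =
      (q , _ , ws′ ++ s) , cong (λ u → decode q , _ , u) (map-++ toℕ ws′ s) ,
      step (dec-true ((decode q , map toℕ ws′ , _) ∈? actions (decode p) (symAt x i) (toℕ Z)) m) mv j≤

    simulate : ∀ {c c′ σ} → observe c ≡ embed σ → Step machine x c c′ →
               ∃ λ σ′ → observe c′ ≡ embed σ′ × SStep σ σ′
    simulate {σ = σ} e st with σ′ , e′ , ss ← astep⁻ σ (symm e) (step⇒ st) = σ′ , symm e′ , ss

    initial : observe (initConfig machine) ≡ embed (running (start 0 0 0 0))
    initial = cong (λ v → just v , 0 , 0 ∷ []) (proj₂ zeros)

    initial-exact : Exact (start 0 0 0 0)
    initial-exact = start-exact 0 0 0 0 z≤n (λ ()) refl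

    digitsOK : ∀ c σ → observe c ≡ embed σ → DigitsOK σ
    digitsOK (suc q , _ , _) (running r) e =
      subst (AllV (_≤ K)) (MaybeP.just-injective (cong proj₁ e)) (digits≤ {8} q)
    digitsOK c (accepted _) e = tt

    -- Covers paths with wrong guesses too: a state stores only digits up to `K`, so the clock
    -- cannot pass `suc K ^ 5`, and each step raises it.
    chain-length : ∀ {c cs σ} → observe c ≡ embed σ → Chain machine x (c ∷ cs) → measure σ + length cs ≤ suc K ^ 5
    chain-length {c} {σ = σ} e (single _) = ≤-trans (≤-reflexive (+-identityʳ _)) (measure-bound σ (digitsOK c σ e))
    chain-length {c} {_ ∷ cs} {σ} e (cons st ch) with σ′ , e′ , ss ← simulate e st =
      ≤-trans (≤-reflexive (+-suc (measure σ) (length cs)))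
        (≤-trans (+-monoˡ-≤ (length cs) (measure-< ss (digitsOK c σ e))) (chain-length e′ ch))

    opaque
      unfolding searchTime

      time-bounded : TimeBounded machine x (searchTime K)
      time-bounded cs (_ , _ , refl , refl , ch) =
        s≤s (≤-trans (m≤n+m _ (measure (running (start 0 0 0 0)))) (chain-length {σ = running (start 0 0 0 0)} initial ch))

    acc-within : ∀ {c cs σ} → observe c ≡ embed σ → AccFrom c cs → Within σ
    acc-within {σ = accepted _} e ac = tt
    acc-within {suc _ , _} {σ = running r} e (stop ())
    acc-within {σ = running r} e (go st ac) with σ′ , e′ , ss ← simulate e st = within-back ss (acc-within e′ ac)

    -- Steps are determined only within the budget; both successors qualify because both lie on
    -- accepting paths.
    unambiguous-from : ∀ {c cs cs′ σ} → observe c ≡ embed σ → Good σ → AccFrom c cs → AccFrom c cs′ → cs ≡ cs′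
    unambiguous-from e gd (stop _) (stop _) = refl
    unambiguous-from e gd (stop a) (go st _) = ⊥-elim (halted a st)
    unambiguous-from e gd (go st _) (stop a) = ⊥-elim (halted a st)
    unambiguous-from {zero , _} e gd (go st ac) (go _ _) = ⊥-elim (halted refl st)
    unambiguous-from {suc _ , _} {σ = running r} e gd (go st ac) (go st′ ac′)
      with σ₁ , e₁ , ss₁ ← simulate e st | σ₂ , e₂ , ss₂ ← simulate e st′
      with refl ← deterministic gd ss₁ (acc-within e₁ ac) ss₂ (acc-within e₂ ac′)
      with refl ← observe-injective _ _ (trans e₁ (symm e₂)) =
      cong (_ ∷_) (unambiguous-from e₁ (good-step ss₁ gd (acc-within e₁ ac)) ac ac′)

    unambiguous : UnambiguousOn machine x
    unambiguous cs cs′ p p′ = unambiguous-from initial initial-exact (fromAccPath p) (fromAccPath p′)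

    good-acc : ∀ {c cs σ} → observe c ≡ embed σ → Good σ → AccFrom c cs → ∃ λ i → Costs.cost Y x (w i) M < B
    good-acc {σ = accepted _} e gd ac = gd
    good-acc {suc _ , _} {σ = running r} e gd (stop ())
    good-acc {σ = running r} e gd (go st ac) with σ′ , e′ , ss ← simulate e st =
      good-acc e′ (good-step ss gd (acc-within e′ ac)) ac

    sound : Accepts machine x → ∃ λ i → Costs.cost Y x (w i) M < B
    sound (cs , p) = good-acc initial initial-exact (fromAccPath p)

    module _ (i⋆ : ℕ) (untied⋆ : ¬ Costs.TiedBelow Y x (w i⋆) (suc M))
             (cost<B : ∀ i → Costs.cost Y x (w i) M < B)
             (C : ℕ) (cost≤C : ∀ i t → t ≤ M → Costs.cost Y x (w i) t ≤ C)
             (i⋆≤K : i⋆ ≤ K) (M≤K : M ≤ K) (x≤K : suc (length x) ≤ K) (MC≤K : M * C ≤ K) (2C≤K : 2 * C ≤ K) where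
      open Costs Y x
      open Progress Y w M B x i⋆ untied⋆ cost<B

      Σ<-cost : ∀ i t → t ≤ M → Σ< t (cost (w i)) ≤ t * C
      Σ<-cost i zero    t≤M = z≤n
      Σ<-cost i (suc t) t<M = +-mono-≤ (cost≤C i t (<⇒≤ t<M)) (Σ<-cost i t (<⇒≤ t<M))

      total≤ : ∀ i {t} ps → t ≤ M → All (_< t) ps → total (w i) ps ≤ length ps * C
      total≤ i [] t≤M [] = z≤n
      total≤ i (p ∷ ps) t≤M (p<t ∷ ps<t) =
        +-mono-≤ (cost≤C i p (≤-trans (<⇒≤ p<t) t≤M)) (total≤ i ps t≤M ps<t)

      -- `spent` is at most the sum `S` of at most `M` costs, and an accumulator is at most the cost
      -- of two premises; this is where `M * C ≤ K` and `2 * C ≤ K` come from.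
      exact-digits : ∀ r → Exact r → Search.family r ≤ i⋆ → Search.head r ≤ suc (length x) → DigitsOK (running r)
      exact-digits (search c i t h s c₀ c₁ S gs) ex i≤ c≤ =
        ≤-trans c≤ x≤K ∷ ≤-trans i≤ i⋆≤K ∷ ≤-trans target≤ M≤K ∷ ≤-trans current≤ (≤-trans target≤ M≤K) ∷
        ≤-trans (≤-trans (≤-trans (m≤m+n s _) (m≤m+n _ _)) (≤-reflexive spent≡)) S≤K ∷
        tracked (dprem t) (dprem< t) (dprem≤2 t) tracks₀ ∷
        tracked (aprem t) (aprem< t) (aprem≤2 t) tracks₁ ∷ S≤K ∷ []
        where
          open Exact ex
          S≤K : S ≤ K
          S≤K = ≤-trans (≤-reflexive budget≡)
            (≤-trans (Σ<-cost i t target≤) (≤-trans (*-monoˡ-≤ C target≤) MC≤K))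
          tracked : ∀ {a} ps → All (_< t) ps → length ps ≤ 2 → Tracks (w i) h a gs ps → a ≤ K
          tracked {a} ps ps<t ps≤2 tr =
            ≤-trans (≤-trans (≤-trans (m≤m+n a _) (m≤m+n _ _)) (≤-reflexive tr))
              (≤-trans (total≤ i ps target≤ ps<t) (≤-trans (*-monoˡ-≤ C ps≤2) 2C≤K))

      realizable : ∀ σ → Good σ → FamilyOK σ → headOf σ ≤ suc (length x) →
                   (∃ λ q → decode q ≡ proj₁ (embed σ)) × All (_≤ M) (proj₂ (proj₂ (embed σ)))
      realizable (accepted _) gd fam h≤ = (zero , refl) , z≤n ∷ []
      realizable (running r@(search c i t h s c₀ c₁ S gs)) ex fam h≤ =
        (suc (proj₁ state) , cong just (proj₂ state)) ,
        AllP.++⁺ (AllP.map⁺ (All.map (λ g<t → ≤-trans g<t (Exact.target≤ ex)) (Exact.agenda< ex))) (z≤n ∷ [])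
        where
          state : ∃ λ q → digits {8} q ≡ digitsOf r
          state = digits-surjective (exact-digits r ex fam h≤)

      head-next : ∀ {a σ} → AStep a (embed σ) → headOf σ ≤ suc (length x)
      head-next {σ = σ} st = ≤-trans (≤-reflexive (embed-head σ)) (next≤ st)
        where
          embed-head : ∀ σ → headOf σ ≡ proj₁ (proj₂ (embed σ))
          embed-head (running _)  = refl
          embed-head (accepted _) = refl
          next≤ : ∀ {a a′} → AStep a a′ → proj₁ (proj₂ a′) ≤ suc (length x)
          next≤ (astep _ _ j≤) = j≤

      -- Each step raises the clock, so clock plus fuel stays above the largest clock value and the
      -- fuel cannot run out before acceptance.
      search-accepts : ∀ fuel c σ → observe c ≡ embed σ → Good σ → FamilyOK σ → headOf σ ≤ suc (length x) →
                       suc K ^ 5 < measure σ + fuel → ∃ λ cs → AccFrom c cs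
      search-accepts fuel (zero , _) (accepted _) e gd fam h≤ lt = _ , stop refl
      search-accepts zero c (running r) e ex fam h≤ lt =
        ⊥-elim (<⇒≱ (subst (suc K ^ 5 <_) (+-identityʳ _) lt) (measure-bound (running r) (digitsOK c (running r) e)))
      search-accepts (suc fuel) c (running r) e ex fam h≤ lt
        with σ′ , ss , wi , fam′ ← progress r ex fam
        with gd′ ← good-step ss ex wi
        with st ← astep⁺ ss h≤
        with q , zs≤ ← realizable σ′ gd′ fam′ (head-next {σ = σ′} st)
        with c′ , e′ , cst ← step⇐ c e st q zs≤
        with cs , ac ← search-accepts fuel c′ σ′ e′ gd′ fam′ (head-next {σ = σ′} st)
               (≤-trans lt (≤-trans (≤-reflexive (+-suc _ fuel))
                 (+-monoˡ-≤ fuel (measure-< ss (digitsOK c (running r) e))))) =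
        c ∷ cs , go cst ac

      complete : Accepts machine x
      complete = proj₁ run , toAccPath (proj₂ run)
        where
          run : ∃ λ cs → AccFrom (initConfig machine) cs
          run = search-accepts (suc (suc K ^ 5)) _ _ initial initial-exact z≤n z≤n
                  (m≤n+m _ (measure (running (start 0 0 0 0))))

-- Items of a goal system

module _ (G q r : ℕ) .{{_ : NonZero G}} (r<G : r < G) where

  remainder : (q * G + r) % G ≡ r
  remainder = trans (cong (_% G) (+-comm (q * G) r)) (trans ([m+kn]%n≡m%n r q G) (m<n⇒m%n≡m r<G))

  quotient : (q * G + r) / G ≡ q
  quotient = *-cancelʳ-≡ _ q G (+-cancelˡ-≡ r _ _ (begin
    r + (q * G + r) / G * G             ≡⟨ cong (_+ (q * G + r) / G * G) (symm remainder) ⟩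
    (q * G + r) % G + (q * G + r) / G * G ≡⟨ symm (m≡m%n+[m/n]*n (q * G + r) G) ⟩
    q * G + r                           ≡⟨ +-comm (q * G) r ⟩
    r + q * G                           ∎))
    where open ≡-Reasoning

-- Rules are indexed by their first premise; [rest g r] is the second premise of rule r for goal g.
record GoalSystem (k : ℕ) : Set where
  field
    maxGoal : ℕ
  Goal : Set
  Goal = Fin (suc maxGoal)
  field
    axiom?  : Goal → Bool
    applies : Goal → Goal → TSym k → Bool
    pos     : Goal → ℕ
    rest    : Goal → Goal → Goal

module _ {k : ℕ} (Q : GoalSystem k) (x : List (Fin k)) where
  open GoalSystem Q

  -- The index counts nodes; it bounds the height and, up to a factor, the cost.
  data Derivation : ℕ → Goal → Set where
    by-axiom : ∀ {g} → axiom? g ≡ true → Derivation 1 g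
    by-rule  : ∀ {g r m n} → applies g r (symAt x (pos g)) ≡ true →
               Derivation m r → Derivation n (rest g r) → Derivation (suc (m + n)) g

-- Item (ℓ, g, r) stands for the derivations of goal g of height ≤ ℓ whose last rule is ≤ r.
module Items {k : ℕ} (Q : GoalSystem k) (B : ℕ) (B>0 : 1 ≤ B) where
  open GoalSystem Q

  G : ℕ
  G = suc maxGoal

  item : ℕ → Goal → Goal → ℕ
  item ℓ g r = (ℓ * G + toℕ g) * G + toℕ r

  top : ℕ → Goal → ℕ
  top ℓ g = item ℓ g (fromℕ maxGoal)

  goalOf ruleOf : ℕ → Goal
  goalOf t = (t / G) mod G
  ruleOf t = t mod G

  levelOf : ℕ → ℕ
  levelOf t = t / G / G

  base : Goal → ℕ
  base g = if axiom? g then 1 else B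

  -- Multiples of `G` are the items with rule 0; their default is the axiom or the failing
  -- derivation. Any other item falls back, at weight 1, on `pred t`: same level and goal, preceding
  -- rule. So the minimum over all rules is a chain of binary choices.
  defaultWeight : ∀ t → Dec (t % G ≡ 0) → ℕ
  defaultWeight t (yes _) = base (goalOf t)
  defaultWeight t (no _)  = 1

  defaultPremises : ∀ t → Dec (t % G ≡ 0) → List ℕ
  defaultPremises t (yes _) = []
  defaultPremises t (no _)  = pred t ∷ []

  rulePremises : ℕ → Goal → Goal → List ℕ
  rulePremises zero    g r = []
  rulePremises (suc ℓ) g r = top ℓ r ∷ top ℓ (rest g r) ∷ []

  ruleApplies : ℕ → Goal → Goal → TSym k → Bool
  ruleApplies zero    g r a = false
  ruleApplies (suc ℓ) g r a = applies g r a

  -- The level is the leading digit of an item, so everything one level down is smaller. Goals alone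
  -- may depend on each other in cycles.
  item< : ∀ ℓ g r {t} → levelOf t ≡ suc ℓ → item ℓ g r < t
  item< ℓ g r {t} e = begin-strict
    (ℓ * G + toℕ g) * G + toℕ r <⟨ +-monoʳ-< ((ℓ * G + toℕ g) * G) (toℕ<n r) ⟩
    (ℓ * G + toℕ g) * G + G     ≡⟨ +-comm _ G ⟩
    suc (ℓ * G + toℕ g) * G     ≤⟨ *-monoˡ-≤ G (+-monoʳ-< (ℓ * G) (toℕ<n g)) ⟩
    (ℓ * G + G) * G             ≡⟨ cong (_* G) (+-comm (ℓ * G) G) ⟩
    suc ℓ * G * G               ≡⟨ cong (λ u → u * G * G) (symm e) ⟩
    t / G / G * G * G           ≤⟨ *-monoˡ-≤ G (m/n*n≤m (t / G) G) ⟩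
    t / G * G                   ≤⟨ m/n*n≤m t G ⟩
    t                           ∎
    where open ≤-Reasoning

  defaultPremises< : ∀ t d → All (_< t) (defaultPremises t d)
  defaultPremises< t       (yes _) = []
  defaultPremises< zero    (no ne) = ⊥-elim (ne refl)
  defaultPremises< (suc t) (no _)  = ≤-refl ∷ []

  system : System k
  system = record
    { dweight   = λ t → defaultWeight t (t % G ≟ 0)
    ; dprem     = λ t → defaultPremises t (t % G ≟ 0)
    ; aprem     = λ t → rulePremises (levelOf t) (goalOf t) (ruleOf t)
    ; applies   = λ t → ruleApplies (levelOf t) (goalOf t) (ruleOf t)
    ; pos       = pos ∘ goalOf
    ; dweight>0 = λ t → weight>0 t (t % G ≟ 0)
    ; dprem<    = λ t → defaultPremises< t (t % G ≟ 0)
    ; aprem<    = λ t → rulePremises< t (levelOf t) refl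
    ; dprem≤2   = λ t → short t (t % G ≟ 0)
    ; aprem≤2   = λ t → ruleShort (levelOf t)
    }
    where
      base>0 : ∀ b → 1 ≤ (if b then 1 else B)
      base>0 true  = ≤-refl
      base>0 false = B>0
      weight>0 : ∀ t d → 1 ≤ defaultWeight t d
      weight>0 t (yes _) = base>0 (axiom? (goalOf t))
      weight>0 t (no _)  = ≤-refl
      rulePremises< : ∀ t ℓ → levelOf t ≡ ℓ → All (_< t) (rulePremises ℓ (goalOf t) (ruleOf t))
      rulePremises< t zero    e = []
      rulePremises< t (suc ℓ) e = item< ℓ _ _ e ∷ item< ℓ _ _ e ∷ []
      short : ∀ t d → length (defaultPremises t d) ≤ 2
      short t (yes _) = z≤n
      short t (no _)  = s≤s z≤n
      ruleShort : ∀ ℓ {g r} → length (rulePremises ℓ g r) ≤ 2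
      ruleShort zero    = z≤n
      ruleShort (suc ℓ) = ≤-refl

  module _ (ℓ : ℕ) (g r : Goal) where

    item-rule : ruleOf (item ℓ g r) ≡ r
    item-rule = toℕ-injective (trans (toℕ-fromℕ< _) (remainder G (ℓ * G + toℕ g) (toℕ r) (toℕ<n r)))

    item-prefix : item ℓ g r / G ≡ ℓ * G + toℕ g
    item-prefix = quotient G (ℓ * G + toℕ g) (toℕ r) (toℕ<n r)

    item-goal : goalOf (item ℓ g r) ≡ g
    item-goal = toℕ-injective (trans (toℕ-fromℕ< _)
      (trans (cong (_% G) item-prefix) (remainder G ℓ (toℕ g) (toℕ<n g))))

    item-level : levelOf (item ℓ g r) ≡ ℓ
    item-level = trans (cong (_/ G) item-prefix) (quotient G ℓ (toℕ g) (toℕ<n g))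

  module _ (x : List (Fin k)) (w : ℕ → ℕ) where
    open Costs system x
    open System system using (dweight; dprem; aprem)

    base≤B : ∀ b → (if b then 1 else B) ≤ B
    base≤B true  = B>0
    base≤B false = ≤-refl

    -- The defaults alone form a derivation: at most `t` steps of weight 1 down to a base of weight
    -- at most `B`.
    cost-bound : ∀ t → cost w t ≤ B + t
    cost-bound zero = ≤-trans (≤-reflexive (cost-≡ w 0)) (≤-trans (pick≤ (ready 0) (dcost w 0) (acost w 0))
      (+-monoˡ-≤ 0 (base≤B (axiom? (goalOf 0)))))
    cost-bound (suc t) = ≤-trans (≤-reflexive (cost-≡ w (suc t))) (≤-trans (pick≤ (ready (suc t)) _ _)
      (by (suc t % G ≟ 0)))
      where
        by : ∀ d → defaultWeight (suc t) d + total w (defaultPremises (suc t) d) ≤ B + suc t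
        by (yes _) = +-mono-≤ (base≤B (axiom? (goalOf (suc t)))) z≤n
        by (no _)  = ≤-trans (s≤s (≤-trans (≤-reflexive (+-identityʳ _)) (cost-bound t)))
                       (≤-reflexive (symm (+-suc B t)))

    dcost-first : ∀ ℓ g → dcost w (item ℓ g zero) ≡ base g
    dcost-first ℓ g = trans (by (t % G ≟ 0)) (cong base (item-goal ℓ g zero))
      where
        t = item ℓ g zero
        by : ∀ d → defaultWeight t d + total w (defaultPremises t d) ≡ base (goalOf t)
        by (yes _) = +-identityʳ _
        by (no ne) = ⊥-elim (ne (remainder G (ℓ * G + toℕ g) 0 (s≤s z≤n)))

    dcost-next : ∀ ℓ g {r r′} → toℕ r ≡ suc (toℕ r′) → dcost w (item ℓ g r) ≡ suc (cost w (item ℓ g r′))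
    dcost-next ℓ g {r} {r′} e = by (t % G ≟ 0)
      where
        t = item ℓ g r
        pred-t : pred t ≡ item ℓ g r′
        pred-t = cong pred (trans (cong ((ℓ * G + toℕ g) * G +_) e) (+-suc _ (toℕ r′)))
        by : ∀ d → defaultWeight t d + total w (defaultPremises t d) ≡ suc (cost w (item ℓ g r′))
        by (yes z) with () ← trans (symm z) (trans (remainder G (ℓ * G + toℕ g) (toℕ r) (toℕ<n r)) e)
        by (no _) = cong suc (trans (+-identityʳ _) (cong (cost w) pred-t))

    ready-zero : ∀ g r → ready (item 0 g r) ≡ false
    ready-zero g r rewrite item-level 0 g r = refl

    ready-suc : ∀ ℓ g r → ready (item (suc ℓ) g r) ≡ applies g r (symAt x (pos g))
    ready-suc ℓ g r rewrite item-level (suc ℓ) g r | item-goal (suc ℓ) g r | item-rule (suc ℓ) g r = refl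

    acost-suc : ∀ ℓ g r → acost w (item (suc ℓ) g r) ≡
                w (item (suc ℓ) g r) + (cost w (top ℓ r) + (cost w (top ℓ (rest g r)) + 0))
    acost-suc ℓ g r rewrite item-level (suc ℓ) g r | item-goal (suc ℓ) g r | item-rule (suc ℓ) g r = refl

    module Soundness (P : Goal → Set) (P-axiom : ∀ g → axiom? g ≡ true → P g)
                     (P-rule : ∀ g r → applies g r (symAt x (pos g)) ≡ true → P r → P (rest g r) → P g) where

      pick-< : ∀ b {a c} → pick b a c < B → a < B ⊎ (b ≡ true × c < B)
      pick-< false lt = inj₁ lt
      pick-< true {a} {c} lt with ⊓-sel a c
      ... | inj₁ e = inj₁ (subst (_< B) e lt)
      ... | inj₂ e = inj₂ (refl , subst (_< B) e lt)

      predecessor : ∀ {n} (r : Fin n) → toℕ r ≡ 0 ⊎ ∃ λ (r′ : Fin n) → toℕ r ≡ suc (toℕ r′)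
      predecessor zero    = inj₁ refl
      predecessor (suc r) = inj₂ (inject₁ r , cong suc (symm (toℕ-inject₁ r)))

      -- A cost below `B` leaves no room for the failing base, so the cheaper choices lead down to
      -- axioms. The recursion is on the level and, within a level, on the rule number `j`.
      derivable : ∀ ℓ j g r → toℕ r ≡ j → cost w (item ℓ g r) < B → P g
      derivable ℓ j g r r≡j lt with pick-< (ready (item ℓ g r)) (subst (_< B) (cost-≡ w (item ℓ g r)) lt)
      derivable ℓ j g r r≡j lt | inj₁ d< = default j r≡j
        where
          by-base : ∀ b → axiom? g ≡ b → (if b then 1 else B) < B → P g
          by-base true  e _  = P-axiom g e
          by-base false e lt = ⊥-elim (<-irrefl refl lt)
          default : ∀ j → toℕ r ≡ j → P g
          default zero e with refl ← toℕ-injective {i = r} {j = zero} e =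
            by-base (axiom? g) refl (subst (_< B) (dcost-first ℓ g) d<)
          default (suc j) e with predecessor r
          ... | inj₁ z with () ← trans (symm z) e
          ... | inj₂ (r′ , e′) = derivable ℓ j g r′ (suc-injective (trans (symm e′) e))
                  (<-trans ≤-refl (subst (_< B) (dcost-next ℓ g {r} {r′} e′) d<))
      derivable zero j g r r≡j lt | inj₂ (rd , _) with () ← trans (symm (ready-zero g r)) rd
      derivable (suc ℓ) j g r r≡j lt | inj₂ (rd , a<) =
        P-rule g r (trans (symm (ready-suc ℓ g r)) rd)
          (derivable ℓ _ r _ refl (≤-<-trans (≤-trans (m≤m+n c₁ _) (m≤n+m _ v)) a<′))
          (derivable ℓ _ (rest g r) _ refl
            (≤-<-trans (≤-trans (≤-trans (m≤m+n c₂ 0) (m≤n+m _ c₁)) (m≤n+m _ v)) a<′))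
        where
          v  = w (item (suc ℓ) g r)
          c₁ = cost w (top ℓ r)
          c₂ = cost w (top ℓ (rest g r))
          a<′ : v + (c₁ + (c₂ + 0)) < B
          a<′ = subst (_< B) (acost-suc ℓ g r) a<

  module _ (x : List (Fin k)) (w : ℕ → ℕ) (V : ℕ) (w≤V : ∀ t → w t ≤ V) where
    open Costs system x

    cost-later : ∀ ℓ g d r r′ → toℕ r′ ≡ d + toℕ r → cost w (item ℓ g r′) ≤ d + cost w (item ℓ g r)
    cost-later ℓ g zero r r′ e with refl ← toℕ-injective e = ≤-refl
    cost-later ℓ g (suc d) r (suc r′) e =
      ≤-trans (≤-reflexive (cost-≡ w (item ℓ g (suc r′)))) (≤-trans (pick≤ (ready (item ℓ g (suc r′))) _ _)
        (≤-trans (≤-reflexive (dcost-next x w ℓ g {suc r′} {inject₁ r′} (cong suc (symm (toℕ-inject₁ r′)))))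
          (s≤s (cost-later ℓ g d r (inject₁ r′) (trans (toℕ-inject₁ r′) (suc-injective e))))))

    cost-top : ∀ ℓ g r → cost w (top ℓ g) ≤ maxGoal + cost w (item ℓ g r)
    cost-top ℓ g r = ≤-trans
      (cost-later ℓ g (maxGoal ∸ toℕ r) r (fromℕ maxGoal)
        (trans (toℕ-fromℕ maxGoal) (symm (m∸n+n≡m (toℕ≤pred[n] r)))))
      (+-monoˡ-≤ _ (m∸n≤m maxGoal (toℕ r)))

    -- Each node costs at most `maxGoal` default steps, from the last rule down to the one used,
    -- plus the weight of that rule, or 1 at an axiom.
    derivation-cost : ∀ {n g} → Derivation Q x n g → ∀ ℓ → n ≤ ℓ → cost w (top ℓ g) ≤ n * (V + G)
    derivation-cost {g = g} (by-axiom ax) ℓ _ = begin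
      cost w (top ℓ g)                 ≤⟨ cost-top ℓ g zero ⟩
      maxGoal + cost w (item ℓ g zero) ≤⟨ +-monoʳ-≤ maxGoal first ⟩
      maxGoal + 1                      ≡⟨ +-comm maxGoal 1 ⟩
      G                                ≤⟨ m≤n+m G V ⟩
      V + G                            ≡⟨ symm (+-identityʳ (V + G)) ⟩
      1 * (V + G)                      ∎
      where
        open ≤-Reasoning
        first : cost w (item ℓ g zero) ≤ 1
        first = ≤-trans (≤-reflexive (cost-≡ w (item ℓ g zero))) (≤-trans (pick≤ (ready (item ℓ g zero)) _ _)
          (≤-reflexive (trans (dcost-first x w ℓ g) (cong (if_then 1 else B) ax))))
    derivation-cost {g = g} (by-rule {r = r} {m} {n} ap d₁ d₂) (suc ℓ) (s≤s m+n≤ℓ) = begin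
      cost w (top (suc ℓ) g)               ≤⟨ cost-top (suc ℓ) g r ⟩
      maxGoal + cost w (item (suc ℓ) g r)  ≤⟨ +-monoʳ-≤ maxGoal rule ⟩
      maxGoal + (V + (m * (V + G) + (n * (V + G) + 0))) ≤⟨ n≤1+n _ ⟩
      suc (maxGoal + (V + (m * (V + G) + (n * (V + G) + 0)))) ≡⟨ lem maxGoal V m n ⟩
      suc (m + n) * (V + G) ∎
      where
        open ≤-Reasoning
        lem : ∀ z V m n → suc (z + (V + (m * (V + suc z) + (n * (V + suc z) + 0)))) ≡ suc (m + n) * (V + suc z)
        lem = solve-∀
        pick-true : ∀ b {a c} → b ≡ true → pick b a c ≤ c
        pick-true true {a} {c} _ = m⊓n≤n a c
        rule : cost w (item (suc ℓ) g r) ≤ V + (m * (V + G) + (n * (V + G) + 0))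
        rule = ≤-trans (≤-reflexive (cost-≡ w (item (suc ℓ) g r)))
          (≤-trans (pick-true (ready (item (suc ℓ) g r)) (trans (ready-suc x w ℓ g r) ap))
            (≤-trans (≤-reflexive (acost-suc x w ℓ g r))
              (+-mono-≤ (w≤V _) (+-mono-≤ (derivation-cost d₁ ℓ (≤-trans (m≤m+n m n) m+n≤ℓ))
                (+-monoˡ-≤ 0 (derivation-cost d₂ ℓ (≤-trans (m≤n+m n m) m+n≤ℓ)))))))

-- The goal system of a pushdown automaton

module Words (g : ℕ) where

  -- Serves for the words that the given automaton may push and, over the input alphabet, for all
  -- inputs up to the ceiling.
  words= words≤ : ℕ → List (List (Fin g))
  words= zero    = [] ∷ []
  words= (suc n) = concatMap (λ a → map (a ∷_) (words= n)) (allFin g)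
  words≤ zero    = words= 0
  words≤ (suc n) = words≤ n ++ words= (suc n)

  ∈-words= : ∀ u → u ∈ words= (length u)
  ∈-words= []      = here refl
  ∈-words= (a ∷ u) = ∈-concatMap⁺ (λ a → map (a ∷_) (words= (length u)))
                       (lose (∈-allFin a) (∈-map⁺ (a ∷_) (∈-words= u)))

  ∈-words≤ : ∀ n u → length u ≤ n → u ∈ words≤ n
  ∈-words≤ zero    []      z≤n = here refl
  ∈-words≤ (suc n) u       u≤ with length u ≤? n
  ... | yes u≤n = ∈-++⁺ˡ (∈-words≤ n u u≤n)
  ... | no  u≰n = ∈-++⁺ʳ (words≤ n) (subst (λ l → u ∈ words= l) (≤-antisym u≤ (≰⇒> u≰n)) (∈-words= u))

  words=-length : ∀ n {u} → u ∈ words= n → length u ≡ n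
  words=-length zero    (here refl) = refl
  words=-length (suc n) u∈
    with a , _ , u∈a ← find (∈-concatMap⁻ (λ a → map (a ∷_) (words= n)) {xs = allFin g} u∈)
    with v , v∈ , refl ← ∈-map⁻ (a ∷_) u∈a = cong suc (words=-length n v∈)

  words≤-length : ∀ n {u} → u ∈ words≤ n → length u ≤ n
  words≤-length zero    (here refl) = z≤n
  words≤-length (suc n) u∈ with ∈-++⁻ (words≤ n) u∈
  ... | inj₁ u∈≤ = m≤n⇒m≤1+n (words≤-length n u∈≤)
  ... | inj₂ u∈= = ≤-reflexive (words=-length (suc n) u∈=)

  length-words= : ∀ n → length (words= n) ≡ g ^ n
  length-words= zero    = refl
  length-words= (suc n) = trans (blocks (allFin g)) (cong₂ _*_ (length-tabulate {n = g} id) (length-words= n))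
    where
      blocks : ∀ as → length (concatMap (λ a → map (a ∷_) (words= n)) as) ≡ length as * length (words= n)
      blocks [] = refl
      blocks (a ∷ as) = trans (length-++ (map (a ∷_) (words= n)))
        (cong₂ _+_ (length-map (a ∷_) (words= n)) (blocks as))

  length-words≤ : ∀ n → length (words≤ n) ≡ sumPow g n
  length-words≤ zero    = refl
  length-words≤ (suc n) = trans (length-++ (words≤ n)) (cong₂ _+_ (length-words≤ n) (length-words= (suc n)))

symAt-before-end : ∀ {k} (x : List (Fin k)) i → i ≤ length x → symAt x i ≢ dollar
symAt-before-end x       zero          i≤ ()
symAt-before-end (a ∷ x) (suc zero)    i≤ ()
symAt-before-end (a ∷ x) (suc (suc i)) (s≤s i≤) e = symAt-before-end x (suc i) i≤ e

module Unpairing (a b c : ℕ) where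
  inner : Fin c × Fin (a * b) → Fin c × (Fin a × Fin b)
  inner (j , v) = j , remQuot b v

  outer : Fin (a * b) × Fin (c * (a * b)) → (Fin a × Fin b) × Fin c × (Fin a × Fin b)
  outer (u , v) = remQuot b u , inner (remQuot (a * b) v)

  pair : (Fin a × Fin b) × Fin c × (Fin a × Fin b) → Fin ((a * b) * (c * (a * b)))
  pair ((q , i) , j , (q′ , i′)) = combine (combine q i) (combine j (combine q′ i′))

  unpair-pair : ∀ s → outer (remQuot {a * b} (c * (a * b)) (pair s)) ≡ s
  unpair-pair ((q , i) , j , (q′ , i′)) =
    trans (cong outer (remQuot-combine (combine q i) (combine j (combine q′ i′))))
      (cong₂ _,_ (remQuot-combine q i)
        (trans (cong inner (remQuot-combine j (combine q′ i′))) (cong (j ,_) (remQuot-combine q′ i′))))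

module Grammar {k : ℕ} (A : 2NPDA k) (P : ℕ) where
  open 2NPDA A
  open Words nΓ

  L nW : ℕ
  L = 3 + P

  -- `Z₀` is listed apart because `e` may be 0. The list is closed under tails, so the second
  -- premise of a rule can name the rest of a word.
  vocabulary : List (List (Fin nΓ))
  vocabulary = (Z₀ ∷ []) ∷ words≤ e

  nW = length vocabulary

  str : Fin nW → List (Fin nΓ)
  str = lookup vocabulary

  index : ∀ {u} → u ∈ vocabulary → ∃ λ j → str j ≡ u
  index u∈ = Any.index u∈ , symm (lookup-index u∈)

  short-word : ∀ u → length u ≤ e → ∃ λ j → str j ≡ u
  short-word u u≤ = index (there (∈-words≤ e u u≤))

  initial-word : ∃ λ j → str j ≡ Z₀ ∷ []
  initial-word = zero , refl

  word-tail : ∀ j → ∃ λ j′ → str j′ ≡ drop 1 (str j)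
  word-tail zero    = short-word [] z≤n
  word-tail (suc j) = short-word (drop 1 (lookup (words≤ e) j))
    (drop≤ (lookup (words≤ e) j) (words≤-length e (∈-lookup {xs = words≤ e} j)))
    where
      drop≤ : ∀ (u : List (Fin nΓ)) {n} → length u ≤ n → length (drop 1 u) ≤ n
      drop≤ []      u≤ = u≤
      drop≤ (_ ∷ u) u≤ = <⇒≤ u≤

  Place Spec : Set
  Place = Fin nQ × Fin L
  Spec = Place × Fin nW × Place

  open Unpairing nQ L nW

  -- No run on an input of length ≤ P reaches position P + 2, so the goal below can only be derived
  -- through an accepting state.
  target : Spec
  target = (q₀ , zero) , proj₁ initial-word , (q₀ , fromℕ (2 + P))

  goals : ℕ
  goals = (nQ * L) * (nW * (nQ * L))

  code : Spec → Fin (suc goals)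
  code s = suc (pair s)

  -- Number 0 is no code; it reads as a second name of the target.
  spec : Fin (suc goals) → Spec
  spec zero    = target
  spec (suc z) = outer (remQuot {nQ * L} (nW * (nQ * L)) z)

  spec-code : ∀ s → spec (code s) ≡ s
  spec-code = unpair-pair

  -- A goal asks for popping a word or accepting on the way, so an accepting state derives every
  -- goal.
  Axiom : Spec → Set
  Axiom (c , j , c′) = (str j ≡ [] × c ≡ c′) ⊎ acc (proj₁ c) ≡ true

  Axiom? : ∀ s → Dec (Axiom s)
  Axiom? (c , j , c′) = (ListP.≡-dec _≟ᶠ_ (str j) [] ×-dec ProductP.≡-dec _≟ᶠ_ _≟ᶠ_ c c′) ⊎-dec (acc (proj₁ c) ≟ᵇ true)

  -- The last condition stands for the bound of `step` by the tape length, which the grammar cannot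
  -- see.
  Fires : TSym k → Fin nΓ → Place → Place → List (Fin nΓ) → Dir → Set
  Fires a Z (q , i) (p , i₁) u d =
    δ q a Z p u d ≡ true × move (toℕ i) d ≡ just (toℕ i₁) × (d ≡ right → a ≢ dollar)

  Fires? : ∀ a Z c c₁ u d → Dec (Fires a Z c c₁ u d)
  Fires? a Z (q , i) (p , i₁) u d =
    (δ q a Z p u d ≟ᵇ true) ×-dec (MaybeP.≡-dec _≟_ (move (toℕ i) d) (just (toℕ i₁)) ×-dec inside d)
    where
      inside : ∀ d → Dec (d ≡ right → a ≢ dollar)
      inside left  = yes λ ()
      inside stay  = yes λ ()
      inside right with dollar? a
      ... | yes e = no λ f → f refl e
      ... | no ne = yes λ _ → ne

  SomeDir : (Dir → Set) → Set
  SomeDir F = F left ⊎ F stay ⊎ F right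

  some-dir : ∀ {F : Dir → Set} d → F d → SomeDir F
  some-dir left  f = inj₁ f
  some-dir stay  f = inj₂ (inj₁ f)
  some-dir right f = inj₂ (inj₂ f)

  the-dir : ∀ {F : Dir → Set} → SomeDir F → ∃ F
  the-dir (inj₁ f)        = left , f
  the-dir (inj₂ (inj₁ f)) = stay , f
  the-dir (inj₂ (inj₂ f)) = right , f

  StepsInto : TSym k → List (Fin nΓ) → Place → Place → List (Fin nΓ) → Set
  StepsInto a []      c c₁ u = ⊥
  StepsInto a (Z ∷ _) c c₁ u = SomeDir (Fires a Z c c₁ u)

  StepsInto? : ∀ a v c c₁ u → Dec (StepsInto a v c c₁ u)
  StepsInto? a []      c c₁ u = no λ ()
  StepsInto? a (Z ∷ _) c c₁ u = Fires? a Z c c₁ u left ⊎-dec (Fires? a Z c c₁ u stay ⊎-dec Fires? a Z c c₁ u right)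

  Into : TSym k → Spec → Spec → Set
  Into a (c , j , _) (c₁ , j₁ , _) = StepsInto a (str j) c c₁ (str j₁)

  into? : ∀ a g r → Dec (Into a g r)
  into? a (c , j , _) (c₁ , j₁ , _) = StepsInto? a (str j) c c₁ (str j₁)

  startOf : Spec → ℕ
  startOf ((_ , i) , _) = toℕ i

  -- The triple construction for pushdown automata: popping `Z ∷ v` from `c` to `c′` is one step,
  -- popping the pushed word from `c₁` to some `c₂`, and popping `v` from `c₂` to `c′`. The first
  -- premise names `c₂` and so fixes the second.
  continue : Spec → Spec → Spec
  continue (_ , j , c′) (_ , _ , c₂) = c₂ , proj₁ (word-tail j) , c′

  grammar : GoalSystem k
  grammar = record
    { maxGoal = goals
    ; axiom?  = λ g → does (Axiom? (spec g))
    ; applies = λ g r a → does (into? a (spec g) (spec r))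
    ; pos     = startOf ∘ spec
    ; rest    = λ g r → code (continue (spec g) (spec r))
    }

  module _ (x : List (Fin k)) where
    open Paths A x

    AcceptsFrom : Config A → Set
    AcceptsFrom c = ∃ λ cs → AccFrom c cs

    -- Continuation-passing form of: popping the word at the first place leads to the second place, or accepts.
    Leads : Spec → Set
    Leads ((q , i) , j , (q′ , i′)) = ∀ s →
      (toℕ i′ ≤ suc (length x) → AcceptsFrom (q′ , toℕ i′ , s)) →
      toℕ i ≤ suc (length x) → AcceptsFrom (q , toℕ i , str j ++ s)

    leads-axiom : ∀ g → Axiom g → Leads g
    leads-axiom ((q , i) , j , _) (inj₁ (u≡ , refl)) s κ i≤ =
      subst (λ u → AcceptsFrom (q , toℕ i , u ++ s)) (symm u≡) (κ i≤)
    leads-axiom g (inj₂ a) s κ i≤ = _ , stop a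

    move-inside : ∀ {i i₁} d → i ≤ suc (length x) → move i d ≡ just i₁ → (d ≡ right → symAt x i ≢ dollar) →
                  i₁ ≤ suc (length x)
    move-inside {suc i} left  i≤ refl ne = <⇒≤ i≤
    move-inside {zero}  stay  i≤ refl ne = i≤
    move-inside {suc i} stay  i≤ refl ne = i≤
    move-inside {zero}  right i≤ refl ne = s≤s z≤n
    move-inside {suc i} right i≤ refl ne = s≤s (symAt-inside x (suc i) (ne refl))

    leads-rule : ∀ g r → Into (symAt x (startOf g)) g r → Leads r → Leads (continue g r) → Leads g
    leads-rule ((q , i) , j , (q′ , i′)) ((p , i₁) , j₁ , (q₂ , i₂)) into l₁ l₂ s κ i≤
      with str j | word-tail j
    ... | Z ∷ v | jt , et with d , δ≡ , mv , ne ← the-dir {Fires (symAt x (toℕ i)) Z (q , i) (p , i₁) (str j₁)} into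
      with i₁≤ ← move-inside d i≤ mv ne
      with cs , ac ← l₁ (v ++ s) (λ i₂≤ → subst (λ u → AcceptsFrom (q₂ , toℕ i₂ , u ++ s)) et (l₂ s κ i₂≤)) i₁≤ =
      _ , go (step δ≡ mv i₁≤) ac

    spec-axiom : ∀ g → does (Axiom? (spec g)) ≡ true → Leads (spec g)
    spec-axiom g a = leads-axiom (spec g) (does⁻ (Axiom? (spec g)) a)

    spec-rule : ∀ g r → does (into? (symAt x (startOf (spec g))) (spec g) (spec r)) ≡ true →
                Leads (spec r) → Leads (spec (code (continue (spec g) (spec r)))) → Leads (spec g)
    spec-rule g r f l₁ l₂ = leads-rule (spec g) (spec r) (does⁻ (into? (symAt x (startOf (spec g))) (spec g) (spec r)) f) l₁
      (subst Leads (spec-code (continue (spec g) (spec r))) l₂)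

    target-accepts : length x ≤ P → Leads target → AcceptsFrom (initConfig A)
    target-accepts x≤P l = l [] unreachable z≤n
      where
        unreachable : toℕ (fromℕ (2 + P)) ≤ suc (length x) → AcceptsFrom (q₀ , toℕ (fromℕ (2 + P)) , [])
        unreachable le = ⊥-elim (<-irrefl refl (≤-trans (≤-trans (≤-reflexive (symm (toℕ-fromℕ (2 + P)))) le) (s≤s x≤P)))

    data AccRun : ℕ → Config A → Set where
      stop : ∀ {c} → acc (proj₁ c) ≡ true → AccRun 0 c
      go   : ∀ {n c c′} → Step A x c c′ → AccRun n c′ → AccRun (suc n) c

    accRun : ∀ {c cs} → AccFrom c cs → ∃ λ n → length cs ≡ suc n × AccRun n c
    accRun (stop a) = 0 , refl , stop a
    accRun (go st ac) with n , e , r ← accRun ac = suc n , cong suc e , go st r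

    Derives : ℕ → Spec → Set
    Derives n g = Derivation grammar x n (code g)

    derives-axiom : ∀ g → Axiom g → Derives 1 g
    derives-axiom g a = by-axiom (dec-true (Axiom? (spec (code g))) (subst Axiom (symm (spec-code g)) a))

    derives-rule : ∀ {m n} g r → Into (symAt x (startOf g)) g r → Derives m r → Derives n (continue g r) → Derives (suc (m + n)) g
    derives-rule {n = n} g r into d₁ d₂ = by-rule {r = code r}
      (dec-true (into? (symAt x (startOf (spec (code g)))) (spec (code g)) (spec (code r)))
        (subst₂ (λ g′ r′ → Into (symAt x (startOf g′)) g′ r′)
          (symm (spec-code g)) (symm (spec-code r)) into))
      d₁ (subst₂ (λ g′ r′ → Derives n (continue g′ r′)) (symm (spec-code g)) (symm (spec-code r)) d₂)

    derivation>0 : ∀ {n g} → Derivation grammar x n g → 1 ≤ n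
    derivation>0 (by-axiom _)    = ≤-refl
    derivation>0 (by-rule _ _ _) = s≤s z≤n

    shorter : ∀ {n m₂ m g} → Derivation grammar x n g → n + 2 * m₂ ≤ suc (2 * m) → m₂ ≤ m
    shorter {m₂ = m₂} d le = *-cancelˡ-≤ 2 (s≤s⁻¹ (≤-trans (+-monoˡ-≤ (2 * m₂) (derivation>0 d)) le))

    module _ (x≤P : length x ≤ P) where

      record FirstStep (m : ℕ) (q : Fin nQ) (i : Fin L) (j : Fin nW) (s : List (Fin nΓ)) : Set where
        field
          q₁    : Fin nQ
          i₁    : Fin L
          j₁    : Fin nW
          i₁≤   : toℕ i₁ ≤ suc (length x)
          into  : StepsInto (symAt x (toℕ i)) (str j) (q , i) (q₁ , i₁) (str j₁)
          after : AccRun m (q₁ , toℕ i₁ , str j₁ ++ str (proj₁ (word-tail j)) ++ s)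

      first-step : ∀ {m q i Z v s} j → str j ≡ Z ∷ v → AccRun (suc m) (q , toℕ i , Z ∷ v ++ s) →
                   FirstStep m q i j s
      first-step {q = q} {i} {Z} {v} {s} j e (go st r) = first st r
        where
          first : ∀ {m c} → Step A x (q , toℕ i , (Z ∷ v) ++ s) c → AccRun m c → FirstStep m q i j s
          first (step {w = u} {d = d} {j = i₁} δ≡ mv i₁≤) r
            with j₁ , refl ← short-word u (push-bound _ _ _ _ _ _ δ≡) = record
            { q₁ = _ ; i₁ = place ; j₁ = j₁ ; i₁≤ = subst (_≤ suc (length x)) (symm place≡) i₁≤
            ; into = subst (λ v → StepsInto (symAt x (toℕ i)) v (q , i) (_ , place) (str j₁)) (symm e)
                (some-dir {Fires (symAt x (toℕ i)) Z (q , i) (_ , place) (str j₁)} d (δ≡ , trans mv (cong just (symm place≡)) , inside d mv))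
            ; after = subst₂ (λ p v → AccRun _ (_ , p , str j₁ ++ v ++ s)) (symm place≡)
                (symm (trans (proj₂ (word-tail j)) (cong (drop 1) e))) r }
            where
              i₁<L : i₁ < L
              i₁<L = s≤s (≤-trans i₁≤ (≤-trans (s≤s x≤P) (n≤1+n _)))
              place  = fromℕ< i₁<L
              place≡ = toℕ-fromℕ< i₁<L
              inside : ∀ d → move (toℕ i) d ≡ just i₁ → d ≡ right → symAt x (toℕ i) ≢ dollar
              inside right mv refl with refl ← trans (symm (move-right (toℕ i))) mv =
                symAt-before-end x (toℕ i) (s≤s⁻¹ i₁≤)

      -- Each step of the run accounts for at most two nodes of the derivation.
      pops : ∀ f m → m ≤ f → ∀ q i j s u → str j ≡ u → toℕ i ≤ suc (length x) →
        AccRun m (q , toℕ i , u ++ s) →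
        Σ Place λ c′ → ∃₂ λ n m′ → toℕ (proj₂ c′) ≤ suc (length x) × Derives n ((q , i) , j , c′) ×
        AccRun m′ (proj₁ c′ , toℕ (proj₂ c′) , s) × n + 2 * m′ ≤ suc (2 * m)
      pops f m m≤f q i j s [] e i≤ r =
        (q , i) , 1 , m , i≤ , derives-axiom ((q , i) , j , (q , i)) (inj₁ (e , refl)) , r , ≤-refl
      -- Accepted before the word is popped: the start place serves as end place, since its state
      -- accepts over `s` at once.
      pops f .0 m≤f q i j s (Z ∷ v) e i≤ (stop a) =
        (q , i) , 1 , 0 , i≤ , derives-axiom ((q , i) , j , (q , i)) (inj₂ a) , stop a , ≤-refl
      pops (suc f) (suc m) (s≤s m≤f) q i j s (Z ∷ v) e i≤ r@(go _ _)
        with record { q₁ = q₁ ; i₁ = i₁ ; j₁ = j₁ ; i₁≤ = i₁≤ ; into = into ; after = r₁ } ← first-step {i = i} j e r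
        with c₂ , n₁ , m₂ , i₂≤ , d₁ , r₂ , le₁ ← pops f m m≤f q₁ i₁ j₁ _ _ refl i₁≤ r₁
        -- `r₂` is no subterm of `r`, only short enough by `shorter`; hence the recursion on `f`.
        with c₃ , n₂ , m₃ , i₃≤ , d₂ , r₃ , le₂ ←
               pops f m₂ (≤-trans (shorter d₁ le₁) m≤f) (proj₁ c₂) (proj₂ c₂) (proj₁ (word-tail j)) s _ refl i₂≤ r₂ =
        c₃ , _ , m₃ , i₃≤ , derives-rule ((q , i) , j , c₃) ((q₁ , i₁) , j₁ , c₂) into d₁ d₂ , r₃ , (begin
          suc (n₁ + n₂) + 2 * m₃   ≡⟨ cong suc (+-assoc n₁ n₂ (2 * m₃)) ⟩
          suc n₁ + (n₂ + 2 * m₃)   ≤⟨ +-monoʳ-≤ (suc n₁) le₂ ⟩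
          suc n₁ + suc (2 * m₂)    ≡⟨ +-suc (suc n₁) (2 * m₂) ⟩
          2 + (n₁ + 2 * m₂)        ≤⟨ +-monoʳ-≤ 2 le₁ ⟩
          2 + suc (2 * m)          ≡⟨ cong suc (symm (*-suc 2 m)) ⟩
          suc (2 * suc m)          ∎)
        where
          open ≤-Reasoning

      -- Nothing lies below the word and an empty stack permits no step, so every branch ends in an
      -- accepting state and the end place is free to be the unreachable one.
      accepts-target : ∀ f m → m ≤ f → ∀ q i j u → str j ≡ u → toℕ i ≤ suc (length x) →
        AccRun m (q , toℕ i , u ++ []) →
        ∃ λ n → n ≤ suc (2 * m) × Derives n ((q , i) , j , proj₂ (proj₂ target))
      accepts-target f .0 m≤f q i j u e i≤ (stop a) = 1 , ≤-refl , derives-axiom ((q , i) , j , proj₂ (proj₂ target)) (inj₂ a)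
      accepts-target f .(suc _) m≤f q i j [] e i≤ (go () _)
      accepts-target (suc f) (suc m) (s≤s m≤f) q i j (Z ∷ v) e i≤ r@(go _ _)
        with record { q₁ = q₁ ; i₁ = i₁ ; j₁ = j₁ ; i₁≤ = i₁≤ ; into = into ; after = r₁ } ← first-step {i = i} j e r
        with c₂ , n₁ , m₂ , i₂≤ , d₁ , r₂ , le₁ ← pops f m m≤f q₁ i₁ j₁ _ _ refl i₁≤ r₁
        with n₂ , le₂ , d₂ ← accepts-target f m₂ (≤-trans (shorter d₁ le₁) m≤f) (proj₁ c₂) (proj₂ c₂)
                               (proj₁ (word-tail j)) _ refl i₂≤ r₂ =
        _ , (begin
          suc (n₁ + n₂)            ≤⟨ s≤s (+-monoʳ-≤ n₁ le₂) ⟩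
          suc n₁ + suc (2 * m₂)    ≡⟨ +-suc (suc n₁) (2 * m₂) ⟩
          2 + (n₁ + 2 * m₂)        ≤⟨ +-monoʳ-≤ 2 le₁ ⟩
          2 + suc (2 * m)          ≡⟨ cong suc (symm (*-suc 2 m)) ⟩
          suc (2 * suc m)          ∎) ,
        derives-rule ((q , i) , j , proj₂ (proj₂ target)) ((q₁ , i₁) , j₁ , c₂) into d₁ d₂
        where
          open ≤-Reasoning

-- Polynomial bounds

_⊞_ : Poly → Poly → Poly
[]      ⊞ q       = q
(a ∷ p) ⊞ []      = a ∷ p
(a ∷ p) ⊞ (b ∷ q) = a + b ∷ p ⊞ q

_⊠_ : Poly → Poly → Poly
[]      ⊠ q = []
(a ∷ p) ⊠ q = map (a *_) q ⊞ (0 ∷ p ⊠ q)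

eval-⊞ : ∀ p q n → eval (p ⊞ q) n ≡ eval p n + eval q n
eval-⊞ []      q       n = refl
eval-⊞ (a ∷ p) []      n = symm (+-identityʳ _)
eval-⊞ (a ∷ p) (b ∷ q) n rewrite eval-⊞ p q n = lem a b n (eval p n) (eval q n)
  where
    lem : ∀ a b n u v → a + b + n * (u + v) ≡ (a + n * u) + (b + n * v)
    lem = solve-∀

eval-scale : ∀ a q n → eval (map (a *_) q) n ≡ a * eval q n
eval-scale a []      n = symm (*-zeroʳ a)
eval-scale a (b ∷ q) n rewrite eval-scale a q n = lem a b n (eval q n)
  where
    lem : ∀ a b n v → a * b + n * (a * v) ≡ a * (b + n * v)
    lem = solve-∀

eval-⊠ : ∀ p q n → eval (p ⊠ q) n ≡ eval p n * eval q n
eval-⊠ []      q n = refl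
eval-⊠ (a ∷ p) q n
  rewrite eval-⊞ (map (a *_) q) (0 ∷ p ⊠ q) n | eval-scale a q n | eval-⊠ p q n =
  lem a n (eval p n) (eval q n)
  where
    lem : ∀ a n u v → a * v + n * (u * v) ≡ (a + n * u) * v
    lem = solve-∀

eval-mono : ∀ p {m n} → m ≤ n → eval p m ≤ eval p n
eval-mono []      le = z≤n
eval-mono (a ∷ p) le = +-monoʳ-≤ a (*-mono-≤ le (eval-mono p le))

eval2-mono : ∀ p n {l m} → l ≤ m → eval2 p n l ≤ eval2 p n m
eval2-mono []      n le = z≤n
eval2-mono (q ∷ p) n le = +-mono-≤ (eval-mono q le) (*-monoʳ-≤ n (eval2-mono p n le))

constant : Poly → Poly2
constant = map (_∷ [])

eval2-constant : ∀ p n m → eval2 (constant p) n m ≡ eval p n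
eval2-constant []      n m = refl
eval2-constant (a ∷ p) n m = cong₂ _+_ (trans (cong (a +_) (*-zeroʳ m)) (+-identityʳ a))
                                       (cong (n *_) (eval2-constant p n m))

PolyBounded : (ℕ → ℕ) → Set
PolyBounded f = Σ Poly λ p → ∀ n → f n ≤ eval p n

poly-eval : ∀ p → PolyBounded (eval p)
poly-eval p = p , λ n → ≤-refl

poly-const : ∀ c → PolyBounded (λ _ → c)
poly-const c = c ∷ [] , λ n → m≤m+n c _

poly-id : PolyBounded (λ n → n)
poly-id = 0 ∷ 1 ∷ [] , λ n → ≤-reflexive (symm (trans (cong (λ u → n * (1 + u)) (*-zeroʳ n)) (*-identityʳ n)))

infixl 6 _+ᵖ_
infixl 7 _*ᵖ_

_+ᵖ_ : ∀ {f g} → PolyBounded f → PolyBounded g → PolyBounded (λ n → f n + g n)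
(p , b) +ᵖ (q , c) = p ⊞ q , λ n → ≤-trans (+-mono-≤ (b n) (c n)) (≤-reflexive (symm (eval-⊞ p q n)))

_*ᵖ_ : ∀ {f g} → PolyBounded f → PolyBounded g → PolyBounded (λ n → f n * g n)
(p , b) *ᵖ (q , c) = p ⊠ q , λ n → ≤-trans (*-mono-≤ (b n) (c n)) (≤-reflexive (symm (eval-⊠ p q n)))

poly-^ : ∀ {f} → PolyBounded f → ∀ e → PolyBounded (λ n → f n ^ e)
poly-^ b zero    = poly-const 1
poly-^ b (suc e) = b *ᵖ poly-^ b e

poly-∘ : ∀ {f} p → PolyBounded f → PolyBounded (λ n → eval p (f n))
poly-∘ []      b = poly-const 0
poly-∘ (a ∷ p) b = poly-const a +ᵖ b *ᵖ poly-∘ p b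

poly2-∘ : ∀ {f} p → PolyBounded f → PolyBounded (λ n → eval2 p n (f n))
poly2-∘ []      b = poly-const 0
poly2-∘ (q ∷ p) b = poly-∘ q b +ᵖ poly-id *ᵖ poly2-∘ p b

sumPow≤ : ∀ k P → sumPow k P ≤ suc k ^ P
sumPow≤ k zero    = ≤-refl
sumPow≤ k (suc P) = +-mono-≤ (sumPow≤ k P) (*-monoʳ-≤ k (^-monoˡ-≤ P (n≤1+n k)))

suc≤2^ : ∀ k → suc k ≤ 2 ^ k
suc≤2^ zero    = ≤-refl
suc≤2^ (suc k) = ≤-trans (+-mono-≤ (m^n>0 2 k) (suc≤2^ k)) (≤-reflexive (cong (2 ^ k +_) (symm (+-identityʳ _))))

-- Bounds the number of inputs of length up to `P`; the exponent is the number of halvings, whence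
-- `families`.
sumPow<2^ : ∀ k P → sumPow k P < 2 ^ suc (k * P)
sumPow<2^ k P = begin-strict
  sumPow k P    ≤⟨ sumPow≤ k P ⟩
  suc k ^ P     ≤⟨ ^-monoˡ-≤ P (suc≤2^ k) ⟩
  (2 ^ k) ^ P   ≡⟨ ^-*-assoc 2 k P ⟩
  2 ^ (k * P)   <⟨ ^-monoʳ-< 2 (s≤s (s≤s z≤n)) {k * P} ≤-refl ⟩
  2 ^ suc (k * P) ∎
  where open ≤-Reasoning

1≤sumPow : ∀ g e → 1 ≤ sumPow g e
1≤sumPow g zero    = ≤-refl
1≤sumPow g (suc e) = ≤-trans (1≤sumPow g e) (m≤m+n _ _)

sumPow-monoˡ : ∀ e {g h} → g ≤ h → sumPow g e ≤ sumPow h e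
sumPow-monoˡ zero    le = ≤-refl
sumPow-monoˡ (suc e) le = +-mono-≤ (sumPow-monoˡ e le) (^-monoˡ-≤ (suc e) le)

opaque
  unfolding searchSize

  searchSize-mono : ∀ K {M M′} → M ≤ M′ → searchSize K M ≤ searchSize K M′
  searchSize-mono K le = *-monoʳ-≤ (suc (suc K ^ 8)) (sumPow-monoˡ 2 (s≤s le))

-- S, P and T bound the size of the given machine, the input length and the running time.
module Bounds (k S P T : ℕ) where
  opaque
    goalBound lastBound weightBound failure families costBound digitBound : ℕ
    goalBound   = suc ((S * (3 + P)) * (suc S * (S * (3 + P))))
    lastBound   = (suc (2 * T) * goalBound + goalBound) * goalBound + goalBound
    weightBound = suc (2 * suc lastBound)
    -- Exceeds the bound of `derivation-cost` for `2 * T + 1` nodes.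
    failure     = suc (suc (2 * T) * (weightBound + goalBound))
    families    = suc (k * P)
    costBound   = failure + lastBound
    -- One summand per kind of register: family, item, head position, spent weight, cost of two
    -- premises.
    digitBound  = families + (lastBound + ((2 + P) + (lastBound * costBound + 2 * costBound)))

module BoundsPoly (k : ℕ) {S P T : ℕ → ℕ} (S-poly : PolyBounded S) (P-poly : PolyBounded P) (T-poly : PolyBounded T) where
  module O n = Bounds k (S n) (P n) (T n)

  opaque
    unfolding Bounds.digitBound searchSize

    level-poly : PolyBounded (λ n → suc (2 * T n))
    level-poly = poly-const 1 +ᵖ poly-const 2 *ᵖ T-poly

    goal-poly : PolyBounded (λ n → O.goalBound n)
    goal-poly = poly-const 1 +ᵖ (S-poly *ᵖ (poly-const 3 +ᵖ P-poly)) *ᵖ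
                  ((poly-const 1 +ᵖ S-poly) *ᵖ (S-poly *ᵖ (poly-const 3 +ᵖ P-poly)))

    last-poly : PolyBounded (λ n → O.lastBound n)
    last-poly = (level-poly *ᵖ goal-poly +ᵖ goal-poly) *ᵖ goal-poly +ᵖ goal-poly

    weight-poly : PolyBounded (λ n → O.weightBound n)
    weight-poly = poly-const 1 +ᵖ poly-const 2 *ᵖ (poly-const 1 +ᵖ last-poly)

    cost-poly : PolyBounded (λ n → O.costBound n)
    cost-poly = (poly-const 1 +ᵖ level-poly *ᵖ (weight-poly +ᵖ goal-poly)) +ᵖ last-poly

    digit-poly : PolyBounded (λ n → O.digitBound n)
    digit-poly = (poly-const 1 +ᵖ poly-const k *ᵖ P-poly) +ᵖ (last-poly +ᵖ ((poly-const 2 +ᵖ P-poly) +ᵖ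
                   (last-poly *ᵖ cost-poly +ᵖ poly-const 2 *ᵖ cost-poly)))

    size-poly : PolyBounded (λ n → searchSize (O.digitBound n) (O.lastBound n))
    size-poly = (poly-const 1 +ᵖ poly-^ (poly-const 1 +ᵖ digit-poly) 8) *ᵖ
      ((poly-const 1 +ᵖ poly-^ (poly-const 1 +ᵖ last-poly) 1) +ᵖ poly-^ (poly-const 1 +ᵖ last-poly) 2)

    time-poly : PolyBounded (λ n → searchTime (O.digitBound n))
    time-poly = poly-^ (poly-const 1 +ᵖ digit-poly) 5

-- The disambiguated automaton

module Disambiguate {k : ℕ} (A : 2NPDA k) (P T : ℕ) where
  open 2NPDA A
  open Grammar A P
  open Bounds k (size A) P T

  maxLevel : ℕ
  maxLevel = suc (2 * T)

  last-item : ℕ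
  last-item = (maxLevel * suc goals + toℕ (code target)) * suc goals + toℕ (Data.Fin.fromℕ goals)

  nQ≤size : nQ ≤ size A
  nQ≤size = ≤-trans (≤-reflexive (symm (*-identityʳ nQ))) (*-monoʳ-≤ nQ (1≤sumPow nΓ e))

  nW≤size : nW ≤ suc (size A)
  nW≤size = s≤s (≤-trans (≤-reflexive (Words.length-words≤ nΓ e))
    (≤-trans (≤-reflexive (symm (+-identityʳ _))) (*-monoˡ-≤ (sumPow nΓ e) (positive q₀))))
    where
      positive : ∀ {n} → Fin n → 1 ≤ n
      positive zero    = s≤s z≤n
      positive (suc _) = s≤s z≤n

  opaque
    unfolding digitBound

    failure>0 : 1 ≤ failure
    failure>0 = s≤s z≤n

    goals≤ : suc goals ≤ goalBound
    goals≤ = s≤s (*-mono-≤ (*-monoˡ-≤ L nQ≤size) (*-mono-≤ nW≤size (*-monoˡ-≤ L nQ≤size)))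

    last≤ : last-item ≤ lastBound
    last≤ = +-mono-≤ (*-mono-≤ (+-mono-≤ (*-monoʳ-≤ maxLevel goals≤) (≤-trans (<⇒≤ (toℕ<n (code target))) goals≤)) goals≤)
                     (≤-trans (<⇒≤ (toℕ<n (Data.Fin.fromℕ goals))) goals≤)

  open Items grammar failure failure>0
  open Words k using (words≤; ∈-words≤; length-words≤)
  open Weights system using (isolating-family)

  opaque
    unfolding digitBound

    isolation : Σ (ℕ → ℕ → ℕ) λ w → (∀ i t → 1 ≤ w i t × w i t ≤ suc (2 * suc last-item)) ×
      (∀ x → x ∈ words≤ P → ∃ λ i → i ≤ families × ¬ Costs.TiedBelow system x (w i) (suc last-item))
    isolation = isolating-family (suc last-item) families (words≤ P)
                  (subst (_< 2 ^ families) (symm (length-words≤ P)) (sumPow<2^ k P))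

  w : ℕ → ℕ → ℕ
  w = proj₁ isolation

  opaque
    unfolding digitBound

    w-bounds : ∀ i t → 1 ≤ w i t × w i t ≤ weightBound
    w-bounds i t = proj₁ (proj₁ (proj₂ isolation) i t) ,
      ≤-trans (proj₂ (proj₁ (proj₂ isolation) i t)) (s≤s (*-monoʳ-≤ 2 (s≤s last≤)))

    families≤ : families ≤ digitBound
    families≤ = m≤m+n families _

    last≤digit : last-item ≤ digitBound
    last≤digit = ≤-trans last≤ (≤-trans (m≤m+n lastBound _) (m≤n+m _ families))

    length≤ : 2 + P ≤ digitBound
    length≤ = ≤-trans (m≤m+n (2 + P) _) (≤-trans (m≤n+m _ lastBound) (m≤n+m _ families))

    products≤ : lastBound * costBound + 2 * costBound ≤ digitBound
    products≤ = ≤-trans (m≤n+m _ (2 + P)) (≤-trans (m≤n+m _ lastBound) (m≤n+m _ families))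

  pos≤ : ∀ t → System.pos system t ≤ digitBound
  pos≤ t = ≤-trans (toℕ≤pred[n] (proj₂ (proj₁ (spec (goalOf t))))) length≤

  open Compiled system w last-item failure digitBound (λ i t → proj₁ (w-bounds i t)) pos≤

  opaque
    unfolding digitBound

    automaton : 2NPDA k
    automaton = machine

    size≤ : size automaton ≤ searchSize digitBound lastBound
    size≤ = ≤-trans (≤-reflexive machine-size) (searchSize-mono digitBound last≤)

    machine-accepts : ∀ {x cs} → length x ≤ P → AccPath A x cs → length cs ≤ suc T → Accepts automaton x
    machine-accepts {x} {cs} x≤P ap cs≤ =
      complete x (proj₁ good) (proj₂ (proj₂ good)) cheap costBound
        (λ i t t≤ → ≤-trans (cost-bound x (w i) t) (+-monoʳ-≤ failure (≤-trans t≤ last≤)))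
        (≤-trans (proj₁ (proj₂ good)) families≤) last≤digit
        (≤-trans (s≤s x≤P) (≤-trans (n≤1+n (suc P)) length≤))
        (≤-trans (*-monoˡ-≤ costBound last≤) (≤-trans (m≤m+n _ (2 * costBound)) products≤))
        (≤-trans (m≤n+m _ (lastBound * costBound)) products≤)
      where
        good : ∃ λ i → i ≤ families × ¬ Costs.TiedBelow system x (w i) (suc last-item)
        good = proj₂ (proj₂ isolation) x (∈-words≤ P x x≤P)
        run : ∃ λ m → length cs ≡ suc m × AccRun x m (initConfig A)
        run = accRun x (Paths.fromAccPath A x ap)
        derived : ∃ λ n → n ≤ suc (2 * proj₁ run) × Derives x n target
        derived = accepts-target x x≤P (proj₁ run) (proj₁ run) ≤-refl q₀ zero (proj₁ initial-word) (Z₀ ∷ []) refl z≤n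
                    (proj₂ (proj₂ run))
        n≤level : proj₁ derived ≤ maxLevel
        n≤level = ≤-trans (proj₁ (proj₂ derived))
          (s≤s (*-monoʳ-≤ 2 (s≤s⁻¹ (≤-trans (≤-reflexive (symm (proj₁ (proj₂ run)))) cs≤))))
        cheap : ∀ i → Costs.cost system x (w i) last-item < failure
        cheap i = s≤s (≤-trans
          (derivation-cost x (w i) weightBound (λ t → proj₂ (w-bounds i t)) (proj₂ (proj₂ derived)) maxLevel n≤level)
          (*-mono-≤ n≤level (+-monoʳ-≤ weightBound goals≤)))

    -- A cost below `failure`, under whichever family gave the verdict, already shows that `target`
    -- leads to acceptance.
    accepts-original : ∀ {x} → length x ≤ P → Accepts automaton x → Accepts A x
    accepts-original {x} x≤P a = proj₁ original , Paths.toAccPath A x (proj₂ original)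
      where
        cheap : ∃ λ i → Costs.cost system x (w i) last-item < failure
        cheap = sound x a
        leads : Leads x (spec (code target))
        leads = Soundness.derivable x (w (proj₁ cheap)) (Leads x ∘ spec) (spec-axiom x) (spec-rule x)
                  maxLevel _ (code target) _ refl (proj₂ cheap)
        original : AcceptsFrom x (initConfig A)
        original = target-accepts x x≤P (subst (Leads x) (spec-code target) leads)

    time : ∀ x → TimeBounded automaton x (searchTime digitBound)
    time = time-bounded

    unique : ∀ x → UnambiguousOn automaton x
    unique = unambiguous

module DisambiguateFamily {k : ℕ} (L : PromiseFamily k) (M : ℕ → 2NPDA k) (s : Poly) (p : Poly2) (ceiling : Poly)
  (size≤ : ∀ n → size (M n) ≤ eval s n) (solves : ∀ n → SolvesWithin L (M n) n (eval2 p n))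
  (ceiling≤ : ∀ n x → (PromiseFamily.Lplus L n x ⊎ PromiseFamily.Lminus L n x) → length x ≤ eval ceiling n) where

  -- Time is taken at the ceiling, so that it depends on `n` alone; `eval2-mono` makes it valid for
  -- shorter inputs.
  P T : ℕ → ℕ
  P n = eval ceiling n
  T n = eval2 p n (P n)

  module D n = Disambiguate (M n) (P n) (T n)
  open BoundsPoly k {λ n → size (M n)} {P} {T} (s , size≤) (poly-eval ceiling) (poly2-∘ p (poly-eval ceiling))

  sizes : Poly
  sizes = proj₁ size-poly

  times : Poly2
  times = constant (proj₁ time-poly)

  automaton-size : ∀ n → size (D.automaton n) ≤ eval sizes n
  automaton-size n = ≤-trans (D.size≤ n) (proj₂ size-poly n)

  automaton-time : ∀ n x → TimeBounded (D.automaton n) x (eval2 times n (length x))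
  automaton-time n x cs path = ≤-trans (D.time n x cs path)
    (s≤s (≤-trans (proj₂ time-poly n) (≤-reflexive (symm (eval2-constant (proj₁ time-poly) n (length x))))))

  automaton-accepts : ∀ n x → PromiseFamily.Lplus L n x → Accepts (D.automaton n) x
  automaton-accepts n x x∈ = D.machine-accepts n short (proj₂ (proj₁ original))
    (≤-trans (proj₂ original (proj₁ (proj₁ original)) (proj₁ (proj₂ (proj₁ original)))) (s≤s (eval2-mono p n short)))
    where
      short = ceiling≤ n x (inj₁ x∈)
      original = proj₁ (solves n) x x∈

  automaton-rejects : ∀ n x → PromiseFamily.Lminus L n x → ¬ Accepts (D.automaton n) x
  automaton-rejects n x x∈ a = proj₁ (proj₂ (solves n) x x∈) (D.accepts-original n (ceiling≤ n x (inj₂ x∈)) a)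

  automaton-solves : ∀ n → SolvesWithin L (D.automaton n) n (eval2 times n)
  automaton-solves n = (λ x x∈ → automaton-accepts n x x∈ , automaton-time n x) ,
                       (λ x x∈ → automaton-rejects n x x∈ , automaton-time n x)

  in2UPD : InPtime2UPD L
  in2UPD = D.automaton , sizes , times , λ n → automaton-size n , automaton-solves n , λ x _ → D.unique n x

theorem5p5 : ∀ (k : ℕ) (L : PromiseFamily k) →
    (InPtime2NPD L × PolyCeiling L) ⇔ (InPtime2UPD L × PolyCeiling L)
theorem5p5 k L = mk⇔
  (λ { ((M , s , p , ok) , (ceiling , ceiling≤)) →
       DisambiguateFamily.in2UPD L M s p ceiling (λ n → proj₁ (ok n)) (λ n → proj₂ (ok n)) ceiling≤ , (ceiling , ceiling≤) })
  (λ { ((M , s , p , ok) , ceil) → (M , s , p , λ n → proj₁ (ok n) , proj₁ (proj₂ (ok n))) , ceil })
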